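{- Let $P\in N_1$ be a sum of $8$ monomials, not necessarily distinct (i.e. $P(1)=8$). Then $P$ has unique factorisation inside $N_1$: any two factorisations of $P$ into irreducible elements of $N_1$ coincide up to the order of the factors.
   Context: $N_1=\mathbb{Z}_{\ge0}[X]$ is the semiring of univariate polynomials with nonnegative integer coefficients. An element $Q\neq0,1$ of $N_1$ is irreducible if in every factorisation $Q=ST$ with $S,T\in N_1$ one of $S,T$ is $1$. -}

module Defs where

open import Data.List.Base using (List; []; _∷_; map; foldr)
open import Data.Nat.Base as ℕ using (ℕ; zero; suc)
open import Data.Sum.Base using (_⊎_)
open import Level using (0ℓ)
open import Relation.Binary.Bundles using (Setoid)
open import Relation.Binary.PropositionalEquality using (_≡_; refl; sym; trans)
open import Relation.Nullary.Negation using (¬_)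

-- The semiring ℤ≥0[X].  The list a₀ ∷ a₁ ∷ … ∷ aₙ ∷ [] stands for
-- a₀ + a₁ X + … + aₙ Xⁿ.  Trailing zeros are allowed, so equality of
-- polynomials is _≈_ below, not _≡_.
N₁ : Set
N₁ = List ℕ

coeff : N₁ → ℕ → ℕ
coeff []      _       = 0
coeff (a ∷ p) zero    = a
coeff (a ∷ p) (suc i) = coeff p i

infix 4 _≈_

_≈_ : N₁ → N₁ → Set
p ≈ q = ∀ i → coeff p i ≡ coeff q i

N₁-setoid : Setoid 0ℓ 0ℓ
N₁-setoid = record
  { Carrier       = N₁
  ; _≈_           = _≈_
  ; isEquivalence = record
    { refl  = λ _ → refl
    ; sym   = λ p≈q i → sym (p≈q i)
    ; trans = λ p≈q q≈r i → trans (p≈q i) (q≈r i)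
    }
  }

0# 1# : N₁
0# = []
1# = 1 ∷ []

infixl 6 _+_
infixl 7 _*_

_+_ : N₁ → N₁ → N₁
[]      + q       = q
(a ∷ p) + []      = a ∷ p
(a ∷ p) + (b ∷ q) = (a ℕ.+ b) ∷ (p + q)

-- (a + X p) q = a q + X (p q)
_*_ : N₁ → N₁ → N₁
[]      * q = []
(a ∷ p) * q = map (a ℕ.*_) q + (0 ∷ p * q)

product : List N₁ → N₁
product = foldr _*_ 1#

eval : N₁ → ℕ → ℕ
eval []      x = 0
eval (a ∷ p) x = a ℕ.+ x ℕ.* eval p x

record Irreducible (Q : N₁) : Set where
  field
    ≉0    : ¬ Q ≈ 0#
    ≉1    : ¬ Q ≈ 1#
    split : ∀ S T → Q ≈ S * T → S ≈ 1# ⊎ T ≈ 1#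

{-# OPTIONS --safe #-}
-- X is prime in N₁, so powers of X can be removed.  The factors then have nonzero constant
-- term, and as P(1) = 8, every reducible P has a factor with two monomials, 1 + Xᵃ.  Two
-- factorisations compare by induction once (1 + Xᵃ) A = (1 + Xᵇ) B with a < b is known to
-- force A = (1 + Xᵇ) C and B = (1 + Xᵃ) C.  Here A and B are multisets of at most four
-- exponents with A ∪ (a + A) = B ∪ (b + B).  The smallest exponent m gives m , a + m ∈ B and
-- the largest, a + b + r, gives r , a + r ∈ B.  If b + m ∈ A or r ∈ A, a parallelogram splits
-- off both sides.  Otherwise B = {m , a + m , r , a + r}, except when r = a + m, where
-- counting the remaining exponents yields a contradiction.
module Submission where

open import Defs
open import Data.List.Base using (List)
open import Data.List.Relation.Unary.All using (All)
open import Data.List.Relation.Binary.Permutation.Setoid N₁-setoid using (_↭_)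
open import Relation.Binary.PropositionalEquality using (_≡_)

open import Algebra.Bundles using (CommutativeMonoid)
import Algebra.Properties.CommutativeSemigroup as CommutativeSemigroupProperties
import Algebra.Solver.CommutativeMonoid as CommutativeMonoidSolver
open import Data.Empty using (⊥; ⊥-elim)
open import Data.List.Base using ([]; _∷_; [_]; _++_; map; length; foldr; drop; replicate)
open import Data.List.Membership.Propositional using (_∈_; _∉_)
open import Data.List.Membership.Propositional.Properties
  using (∈-++⁻; ∈-++⁺ˡ; ∈-++⁺ʳ; ∈-map⁻; ∈-map⁺)
import Data.List.Properties as List
import Data.List.Relation.Binary.Permutation.Propositional as Bag
open Bag using (prep; swap) renaming (_↭_ to _≋_)
import Data.List.Relation.Binary.Permutation.Propositional.Properties as Bag
import Data.List.Relation.Binary.Permutation.Setoid N₁-setoid as Perm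
import Data.List.Relation.Binary.Permutation.Setoid.Properties N₁-setoid as Permₚ
open import Data.List.Relation.Unary.All as All using ([]; _∷_)
open import Data.List.Relation.Unary.AllPairs using ([]; _∷_)
open import Data.List.Relation.Unary.Any using (Any; here; there)
open import Data.List.Relation.Unary.Unique.Propositional using (Unique)
open import Data.Nat.Base as ℕ using (ℕ; zero; suc; _≤_; _<_; z≤n; s≤s)
import Data.Nat.Properties as ℕ
open import Data.List.Membership.DecPropositional ℕ._≟_ using (_∈?_)
open import Data.Product.Base using (∃; ∃₂; _×_; _,_; proj₁; proj₂)
open import Data.Sum.Base as Sum using (_⊎_; inj₁; inj₂; [_,_]′)
open import Function.Base using (flip; _∘_)
open import Level using (0ℓ)
open import Relation.Binary.Bundles using (Setoid)
open import Relation.Binary.Core using (Rel)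
open import Relation.Binary.Definitions
  using (Reflexive; Transitive; Total; tri<; tri≈; tri>)
open import Relation.Binary.PropositionalEquality
  using (_≢_; refl; sym; trans; cong; cong₂; subst; ≢-sym; module ≡-Reasoning)
import Relation.Binary.Reasoning.Setoid as SetoidReasoning
open import Relation.Nullary.Decidable using (yes; no)

open CommutativeSemigroupProperties ℕ.+-commutativeSemigroup using ()
  renaming (x∙yz≈y∙xz to ℕ-+-left-comm; interchange to ℕ-+-interchange)
open CommutativeSemigroupProperties ℕ.*-commutativeSemigroup using ()
  renaming (x∙yz≈y∙xz to ℕ-*-left-comm)

-- Multisets as lists up to permutation

module _ {a} {A : Set a} where

  extract : ∀ {x : A} {xs} → x ∈ xs → ∃ λ ys → xs ≋ x ∷ ys
  extract {xs = _ ∷ xs} (here refl) = xs , Bag.refl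
  extract {xs = y ∷ _} (there x∈xs) with ys , xs≋x∷ys ← extract x∈xs =
    y ∷ ys , Bag.trans (prep y xs≋x∷ys) (swap y _ Bag.refl)

  ∈-∷⁻-≢ : ∀ {x z : A} {ys} → z ≢ x → z ∈ x ∷ ys → z ∈ ys
  ∈-∷⁻-≢ z≢x (here z≡x)   = ⊥-elim (z≢x z≡x)
  ∈-∷⁻-≢ z≢x (there z∈ys) = z∈ys

  -- Membership does not see multiplicity: distinctness keeps the other members available once `x`
  -- has been removed.
  extract-unique : ∀ {xs ys : List A} → Unique xs → All (_∈ ys) xs →
                   ∃ λ zs → ys ≋ xs ++ zs
  extract-unique {ys = ys} [] [] = ys , Bag.refl
  extract-unique {xs = x ∷ xs} (x∉xs ∷ xs!) (x∈ys ∷ xs⊆ys)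
    with ys′ , ys≋ ← extract x∈ys
    with zs , ys′≋ ← extract-unique xs! (All.zipWith
           (λ (x≢z , z∈ys) → ∈-∷⁻-≢ (≢-sym x≢z) (Bag.∈-resp-↭ ys≋ z∈ys)) (x∉xs , xs⊆ys))
    = zs , Bag.trans ys≋ (prep x ys′≋)

  pair-inv : ∀ {x y z w : A} → x ∷ y ∷ [] ≋ z ∷ w ∷ [] →
             (x ≡ z × y ≡ w) ⊎ (x ≡ w × y ≡ z)
  pair-inv {x} {y} {z} {w} xy≋zw with Bag.∈-resp-↭ xy≋zw (here refl)
  ... | here refl with refl ← Bag.↭-singleton-inv (Bag.drop-∷ xy≋zw) = inj₁ (refl , refl)
  ... | there (here refl)
    with refl ← Bag.↭-singleton-inv (Bag.drop-∷ (Bag.trans xy≋zw (swap z w Bag.refl)))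
    = inj₂ (refl , refl)

  drop-++ˡ : ∀ (xs : List A) {ys zs} → xs ++ ys ≋ xs ++ zs → ys ≋ zs
  drop-++ˡ []       eq = eq
  drop-++ˡ (x ∷ xs) eq = drop-++ˡ xs (Bag.drop-∷ eq)

  length-rest : ∀ (xs : List A) {ys zs n} → ys ≋ xs ++ zs →
                length ys ≡ length xs ℕ.+ n → length zs ≡ n
  length-rest xs {zs = zs} {n} ys≋ ∣ys∣≡ =
    ℕ.+-cancelˡ-≡ (length xs) (length zs) n
      (trans (sym (List.length-++ xs)) (trans (sym (Bag.↭-length ys≋)) ∣ys∣≡))

  length-0 : ∀ {xs : List A} → length xs ≡ 0 → xs ≡ []
  length-0 {[]} _ = refl

  length-1 : ∀ {xs : List A} → length xs ≡ 1 → ∃ λ x → xs ≡ [ x ]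
  length-1 {x ∷ []} _ = x , refl

open CommutativeMonoidSolver (Bag.++-commutativeMonoid {A = ℕ})
  using (_⊕_; _⊜_) renaming (solve to solve-bag)

module _ {a ℓ} {A : Set a} {_≲_ : Rel A ℓ}
         (rfl : Reflexive _≲_) (trns : Transitive _≲_) (total : Total _≲_) where

  -- The order is a parameter so that reversing it yields the maximum.
  least : ∀ x xs → ∃ λ m → m ∈ x ∷ xs × All (m ≲_) (x ∷ xs)
  least x [] = x , here refl , rfl ∷ []
  least x (y ∷ ys) with m , m∈ , m≲ ← least y ys with total x m
  ... | inj₁ x≲m = x , here refl , rfl ∷ All.map (trns x≲m) m≲
  ... | inj₂ m≲x = m , there m∈ , m≲x ∷ m≲

minimum : ∀ x xs → ∃ λ m → m ∈ x ∷ xs × All (m ≤_) (x ∷ xs)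
minimum = least ℕ.≤-refl ℕ.≤-trans ℕ.≤-total

maximum : ∀ x xs → ∃ λ m → m ∈ x ∷ xs × All (_≤ m) (x ∷ xs)
maximum = least ℕ.≤-refl (flip ℕ.≤-trans) (flip ℕ.≤-total)

-- If A lists the exponents of a polynomial, a ⊞ A lists those of its product by 1 + Xᵃ.
infixr 6 _⊞_

_⊞_ : ℕ → List ℕ → List ℕ
a ⊞ A = A ++ map (a ℕ.+_) A

module _ {a : ℕ} where

  ⊞-∷ : ∀ x A → a ⊞ (x ∷ A) ≋ x ∷ a ℕ.+ x ∷ a ⊞ A
  ⊞-∷ x A = prep x (Bag.shift (a ℕ.+ x) A (map (a ℕ.+_) A))

  ⊞-resp-≋ : ∀ {A B} → A ≋ B → a ⊞ A ≋ a ⊞ B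
  ⊞-resp-≋ A≋B = Bag.++⁺ A≋B (Bag.map⁺ (a ℕ.+_) A≋B)

  ∈-⊞⁻ : ∀ {y} A → y ∈ a ⊞ A → y ∈ A ⊎ ∃ λ x → x ∈ A × y ≡ a ℕ.+ x
  ∈-⊞⁻ A y∈ with ∈-++⁻ A y∈
  ... | inj₁ y∈A = inj₁ y∈A
  ... | inj₂ y∈a+A = inj₂ (∈-map⁻ (a ℕ.+_) y∈a+A)

  -- An occurrence in the shifted copy would, by cancelling `a`, put `x` itself into `A`.
  ∈-⊞⁻-∉ : ∀ {x A} → x ∉ A → a ℕ.+ x ∈ a ⊞ A → a ℕ.+ x ∈ A
  ∈-⊞⁻-∉ {x} {A} x∉A a+x∈ with ∈-⊞⁻ A a+x∈
  ... | inj₁ a+x∈A = a+x∈A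
  ... | inj₂ (y , y∈A , a+x≡a+y) =
    ⊥-elim (x∉A (subst (_∈ A) (sym (ℕ.+-cancelˡ-≡ a x y a+x≡a+y)) y∈A))

  ∈-⊞⁺ˡ : ∀ {y A} → y ∈ A → y ∈ a ⊞ A
  ∈-⊞⁺ˡ = ∈-++⁺ˡ

  ∈-⊞⁺ʳ : ∀ {y A} → y ∈ A → a ℕ.+ y ∈ a ⊞ A
  ∈-⊞⁺ʳ {A = A} y∈A = ∈-++⁺ʳ A (∈-map⁺ (a ℕ.+_) y∈A)

  ⊞-≤ : ∀ {A m} → All (m ≤_) A → ∀ {y} → y ∈ a ⊞ A → m ≤ y
  ⊞-≤ {A} m≤A y∈ with ∈-⊞⁻ A y∈
  ... | inj₁ y∈A = All.lookup m≤A y∈A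
  ... | inj₂ (x , x∈A , refl) = ℕ.≤-trans (All.lookup m≤A x∈A) (ℕ.m≤n+m x a)

  ⊞-≥ : ∀ {A m} → All (_≤ m) A → ∀ {y} → y ∈ a ⊞ A → y ≤ a ℕ.+ m
  ⊞-≥ {A} {m} A≤m y∈ with ∈-⊞⁻ A y∈
  ... | inj₁ y∈A = ℕ.≤-trans (All.lookup A≤m y∈A) (ℕ.m≤n+m m a)
  ... | inj₂ (x , x∈A , refl) = ℕ.+-monoʳ-≤ a (All.lookup A≤m x∈A)

-- The equation `a ⊞ A ≋ b ⊞ B`: cancelling common exponents

module _ {a b : ℕ} where

  -- Both sides lose `x`, `a + x`, `b + x` and `a + b + x`, the exponents of (1 + Xᵃ)(1 + Xᵇ)Xˣ, a
  -- parallelogram generated by either removed pair.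
  split-off : ∀ x {A A′ B B′} → A ≋ x ∷ b ℕ.+ x ∷ A′ → B ≋ x ∷ a ℕ.+ x ∷ B′ →
              a ⊞ A ≋ b ⊞ B → a ⊞ A′ ≋ b ⊞ B′
  split-off x {A} {A′} {B} {B′} A≋ B≋ aA≋bB =
    Bag.drop-∷ (Bag.drop-∷ (Bag.drop-∷ (Bag.drop-∷ (begin
      x ∷ a ℕ.+ x ∷ b ℕ.+ x ∷ a ℕ.+ (b ℕ.+ x) ∷ a ⊞ A′  ↭⟨ prep _ (prep _ (⊞-∷ (b ℕ.+ x) A′)) ⟨
      x ∷ a ℕ.+ x ∷ a ⊞ (b ℕ.+ x ∷ A′)  ↭⟨ ⊞-∷ x (b ℕ.+ x ∷ A′) ⟨
      a ⊞ (x ∷ b ℕ.+ x ∷ A′)  ↭⟨ ⊞-resp-≋ A≋ ⟨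
      a ⊞ A  ↭⟨ aA≋bB ⟩
      b ⊞ B  ↭⟨ ⊞-resp-≋ B≋ ⟩
      b ⊞ (x ∷ a ℕ.+ x ∷ B′)  ↭⟨ ⊞-∷ x (a ℕ.+ x ∷ B′) ⟩
      x ∷ b ℕ.+ x ∷ b ⊞ (a ℕ.+ x ∷ B′)  ↭⟨ prep _ (prep _ (⊞-∷ (a ℕ.+ x) B′)) ⟩
      x ∷ b ℕ.+ x ∷ a ℕ.+ x ∷ b ℕ.+ (a ℕ.+ x) ∷ b ⊞ B′  ↭⟨ prep x (swap _ _ Bag.refl) ⟩
      x ∷ a ℕ.+ x ∷ b ℕ.+ x ∷ b ℕ.+ (a ℕ.+ x) ∷ b ⊞ B′
        ≡⟨ cong (λ y → x ∷ a ℕ.+ x ∷ b ℕ.+ x ∷ y ∷ b ⊞ B′) (ℕ-+-left-comm b a x) ⟩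
      x ∷ a ℕ.+ x ∷ b ℕ.+ x ∷ a ℕ.+ (b ℕ.+ x) ∷ b ⊞ B′ ∎))))
    where open Bag.PermutationReasoning

  -- With `s = 2a + m` one has `a + p = b + s`, and `a + s = b + m` is given. Together with `m`,
  -- `a + m`, `s` and `p` this matches six exponents on each side.
  hexagon-rest : ∀ {m s t w} → a ℕ.+ s ≡ b ℕ.+ m → s ≡ a ℕ.+ (a ℕ.+ m) →
    a ⊞ (m ∷ s ∷ b ℕ.+ (a ℕ.+ m) ∷ t ∷ []) ≋ b ⊞ (m ∷ a ℕ.+ m ∷ s ∷ w ∷ []) →
    a ⊞ [ t ] ≋ b ⊞ [ w ]
  hexagon-rest {m} {s} {t} {w} a+s≡b+m refl eq =
    drop-++ˡ (m ∷ s ∷ p ∷ a ℕ.+ m ∷ a ℕ.+ s ∷ b ℕ.+ s ∷ []) (begin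
      m ∷ s ∷ p ∷ a ℕ.+ m ∷ a ℕ.+ s ∷ b ℕ.+ s ∷ a ⊞ [ t ]
        ≡⟨ cong (λ x → m ∷ s ∷ p ∷ a ℕ.+ m ∷ a ℕ.+ s ∷ x ∷ a ⊞ [ t ]) (ℕ-+-left-comm b a (a ℕ.+ m)) ⟩
      m ∷ s ∷ p ∷ a ℕ.+ m ∷ a ℕ.+ s ∷ a ℕ.+ p ∷ a ⊞ [ t ]
        ↭⟨ solve-bag 8 (λ x₁ x₂ x₃ x₄ x₅ x₆ y z →
             x₁ ⊕ x₂ ⊕ x₃ ⊕ x₄ ⊕ x₅ ⊕ x₆ ⊕ y ⊕ z ⊜ x₁ ⊕ x₂ ⊕ x₃ ⊕ y ⊕ x₄ ⊕ x₅ ⊕ x₆ ⊕ z)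
             Bag.refl [ m ] [ s ] [ p ] [ a ℕ.+ m ] [ a ℕ.+ s ] [ a ℕ.+ p ] [ t ] [ a ℕ.+ t ] ⟩
      a ⊞ (m ∷ s ∷ p ∷ t ∷ [])
        ↭⟨ eq ⟩
      b ⊞ (m ∷ a ℕ.+ m ∷ s ∷ w ∷ [])
        ↭⟨ solve-bag 8 (λ x₁ x₂ x₃ x₄ x₅ x₆ y z →
             x₁ ⊕ x₄ ⊕ x₂ ⊕ y ⊕ x₅ ⊕ x₃ ⊕ x₆ ⊕ z ⊜ x₁ ⊕ x₂ ⊕ x₃ ⊕ x₄ ⊕ x₅ ⊕ x₆ ⊕ y ⊕ z)
             Bag.refl [ m ] [ s ] [ p ] [ a ℕ.+ m ] [ b ℕ.+ m ] [ b ℕ.+ s ] [ w ] [ b ℕ.+ w ] ⟩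
      m ∷ s ∷ p ∷ a ℕ.+ m ∷ b ℕ.+ m ∷ b ℕ.+ s ∷ b ⊞ [ w ]
        ≡⟨ cong (λ x → m ∷ s ∷ p ∷ a ℕ.+ m ∷ x ∷ b ℕ.+ s ∷ b ⊞ [ w ]) a+s≡b+m ⟨
      m ∷ s ∷ p ∷ a ℕ.+ m ∷ a ℕ.+ s ∷ b ℕ.+ s ∷ b ⊞ [ w ] ∎)
    where
    open Bag.PermutationReasoning
    p = b ℕ.+ (a ℕ.+ m)

  -- Here `a + p = b + q` holds by commuting summands, so six exponents match much as in
  -- `hexagon-rest`; this time `s` is not among them and stays behind with `a + q`.
  octagon-rest : ∀ {m s w} → a ℕ.+ s ≡ b ℕ.+ m →
    a ⊞ (m ∷ s ∷ a ℕ.+ (a ℕ.+ m) ∷ b ℕ.+ (a ℕ.+ m) ∷ []) ≋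
      b ⊞ (m ∷ a ℕ.+ m ∷ a ℕ.+ (a ℕ.+ m) ∷ w ∷ []) →
    s ∷ a ℕ.+ (a ℕ.+ (a ℕ.+ m)) ∷ [] ≋ b ⊞ [ w ]
  octagon-rest {m} {s} {w} a+s≡b+m eq =
    drop-++ˡ (m ∷ q ∷ p ∷ a ℕ.+ m ∷ a ℕ.+ s ∷ b ℕ.+ q ∷ []) (begin
      m ∷ q ∷ p ∷ a ℕ.+ m ∷ a ℕ.+ s ∷ b ℕ.+ q ∷ s ∷ a ℕ.+ q ∷ []
        ≡⟨ cong (λ x → m ∷ q ∷ p ∷ a ℕ.+ m ∷ a ℕ.+ s ∷ x ∷ s ∷ a ℕ.+ q ∷ []) (ℕ-+-left-comm b a (a ℕ.+ m)) ⟩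
      m ∷ q ∷ p ∷ a ℕ.+ m ∷ a ℕ.+ s ∷ a ℕ.+ p ∷ s ∷ a ℕ.+ q ∷ []
        ↭⟨ solve-bag 8 (λ x₁ x₂ x₃ x₄ x₅ x₆ y z →
             x₁ ⊕ x₂ ⊕ x₃ ⊕ x₄ ⊕ x₅ ⊕ x₆ ⊕ y ⊕ z ⊜ x₁ ⊕ y ⊕ x₂ ⊕ x₃ ⊕ x₄ ⊕ x₅ ⊕ z ⊕ x₆)
             Bag.refl [ m ] [ q ] [ p ] [ a ℕ.+ m ] [ a ℕ.+ s ] [ a ℕ.+ p ] [ s ] [ a ℕ.+ q ] ⟩
      a ⊞ (m ∷ s ∷ q ∷ p ∷ [])
        ↭⟨ eq ⟩
      b ⊞ (m ∷ a ℕ.+ m ∷ q ∷ w ∷ [])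
        ↭⟨ solve-bag 8 (λ x₁ x₂ x₃ x₄ x₅ x₆ y z →
             x₁ ⊕ x₄ ⊕ x₂ ⊕ y ⊕ x₅ ⊕ x₃ ⊕ x₆ ⊕ z ⊜ x₁ ⊕ x₂ ⊕ x₃ ⊕ x₄ ⊕ x₅ ⊕ x₆ ⊕ y ⊕ z)
             Bag.refl [ m ] [ q ] [ p ] [ a ℕ.+ m ] [ b ℕ.+ m ] [ b ℕ.+ q ] [ w ] [ b ℕ.+ w ] ⟩
      m ∷ q ∷ p ∷ a ℕ.+ m ∷ b ℕ.+ m ∷ b ℕ.+ q ∷ b ⊞ [ w ]
        ≡⟨ cong (λ x → m ∷ q ∷ p ∷ a ℕ.+ m ∷ x ∷ b ℕ.+ q ∷ b ⊞ [ w ]) a+s≡b+m ⟨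
      m ∷ q ∷ p ∷ a ℕ.+ m ∷ a ℕ.+ s ∷ b ℕ.+ q ∷ b ⊞ [ w ] ∎)
    where
    open Bag.PermutationReasoning
    p = b ℕ.+ (a ℕ.+ m)
    q = a ℕ.+ (a ℕ.+ m)

  -- Eliminating `s` leaves `2b + m = 4a + m`; once `m` is cancelled, `ℕ.⌊_/2⌋` removes the factor
  -- 2.
  octagon-b≡2a : ∀ {m s} → a ℕ.+ s ≡ b ℕ.+ m → a ℕ.+ (a ℕ.+ (a ℕ.+ m)) ≡ b ℕ.+ s → b ≡ a ℕ.+ a
  octagon-b≡2a {m} {s} a+s≡b+m 3a+m≡b+s =
    trans (ℕ.n≡⌊n+n/2⌋ b) (trans (cong ℕ.⌊_/2⌋ (ℕ.+-cancelʳ-≡ m _ _ (begin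
      b ℕ.+ b ℕ.+ m                    ≡⟨ ℕ.+-assoc b b m ⟩
      b ℕ.+ (b ℕ.+ m)                  ≡⟨ cong (b ℕ.+_) a+s≡b+m ⟨
      b ℕ.+ (a ℕ.+ s)                  ≡⟨ ℕ-+-left-comm b a s ⟩
      a ℕ.+ (b ℕ.+ s)                  ≡⟨ cong (a ℕ.+_) 3a+m≡b+s ⟨
      a ℕ.+ (a ℕ.+ (a ℕ.+ (a ℕ.+ m)))  ≡⟨ ℕ.+-assoc a a _ ⟨
      a ℕ.+ a ℕ.+ (a ℕ.+ (a ℕ.+ m))    ≡⟨ cong (a ℕ.+ a ℕ.+_) (ℕ.+-assoc a a m) ⟨
      a ℕ.+ a ℕ.+ (a ℕ.+ a ℕ.+ m)      ≡⟨ ℕ.+-assoc (a ℕ.+ a) (a ℕ.+ a) m ⟨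
      a ℕ.+ a ℕ.+ (a ℕ.+ a) ℕ.+ m      ∎))) (sym (ℕ.n≡⌊n+n/2⌋ (a ℕ.+ a))))
    where open ≡-Reasoning

  -- Extremal exponents for `a < b`, and the cases of two and four exponents

  module _ (a<b : a < b) where

    private
      x<b+x : ∀ x → x < b ℕ.+ x
      x<b+x x = ℕ.m<n+m x (ℕ.≤-<-trans ℕ.z≤n a<b)

    -- Every `b + z` with `z` at least `m` exceeds `a + m`, so `a + m` can only be an unshifted
    -- exponent. The head `b + m` is what `m` leaves behind when `bottom` cancels its unshifted
    -- copy.
    a+min∈ : ∀ m B → (∀ {z} → z ∈ B → m ≤ z) → a ℕ.+ m ∈ b ℕ.+ m ∷ b ⊞ B → a ℕ.+ m ∈ B
    a+min∈ m B m≤B (here a+m≡b+m) = ⊥-elim (ℕ.<⇒≢ a<b (ℕ.+-cancelʳ-≡ m a b a+m≡b+m))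
    a+min∈ m B m≤B (there a+m∈b⊞B) with ∈-⊞⁻ B a+m∈b⊞B
    ... | inj₁ a+m∈B = a+m∈B
    ... | inj₂ (y , y∈B , a+m≡b+y) =
      ⊥-elim (ℕ.<⇒≢ (ℕ.+-mono-<-≤ a<b (m≤B y∈B)) a+m≡b+y)

    -- Adding copies shifted upwards does not change the minimum, so both lists have the same one.
    -- Once `m` is cancelled, `a + m` still has to be matched, and `a+min∈` finds it in the rest of
    -- `B`; for `a = 0` this is a second occurrence of `m`.
    bottom : ∀ {x A B} → a ⊞ (x ∷ A) ≋ b ⊞ B →
             ∃ λ m → (∀ {y} → y ∈ a ⊞ (x ∷ A) → m ≤ y) × m ∈ x ∷ A ×
             ∃ λ B′ → B ≋ m ∷ a ℕ.+ m ∷ B′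
    bottom {B = []} eq = ⊥-elim (Bag.¬x∷xs↭[] eq)
    bottom {x} {A} {B = y ∷ B} eq
      with m , m∈A , m≤A ← minimum x A
      with n , n∈B , n≤B ← minimum y B
      with refl ← ℕ.≤-antisym (⊞-≤ m≤A (Bag.∈-resp-↭ (Bag.↭-sym eq) (∈-⊞⁺ˡ n∈B)))
                              (⊞-≤ n≤B (Bag.∈-resp-↭ eq (∈-⊞⁺ˡ m∈A)))
      with A₁ , A≋ ← extract m∈A
      with B₁ , B≋ ← extract n∈B
      with eq′ ← Bag.drop-∷ (Bag.trans (Bag.trans (Bag.↭-sym (⊞-∷ m A₁)) (⊞-resp-≋ (Bag.↭-sym A≋)))
                   (Bag.trans eq (Bag.trans (⊞-resp-≋ B≋) (⊞-∷ m B₁))))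
      with B₂ , B₁≋ ← extract (a+min∈ m B₁
             (λ z∈ → All.lookup n≤B (Bag.∈-resp-↭ (Bag.↭-sym B≋) (there z∈)))
             (Bag.∈-resp-↭ eq′ (here refl)))
      = m , ⊞-≤ m≤A , m∈A , B₂ , Bag.trans B≋ (prep m B₁≋)

    -- The maxima satisfy `a + p = b + q`. Now `p` also occurs on the right, and not in `B`, since
    -- `p ≤ q` would give `a + p < b + q`. So it is some `b + r`, and cancelling `b` gives
    -- `q = a + r`.
    top : ∀ {x A B} → a ⊞ (x ∷ A) ≋ b ⊞ B →
          ∃ λ r → r ∈ B × a ℕ.+ r ∈ B × b ℕ.+ r ∈ x ∷ A
    top {B = []} eq = ⊥-elim (Bag.¬x∷xs↭[] eq)
    top {x} {A} {B = y ∷ B} eq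
      with p , p∈A , A≤p ← maximum x A
      with q , q∈B , B≤q ← maximum y B
      with a+p≡b+q ← ℕ.≤-antisym (⊞-≥ B≤q (Bag.∈-resp-↭ eq (∈-⊞⁺ʳ p∈A)))
                                 (⊞-≥ A≤p (Bag.∈-resp-↭ (Bag.↭-sym eq) (∈-⊞⁺ʳ q∈B)))
      with ∈-⊞⁻ (y ∷ B) (Bag.∈-resp-↭ eq (∈-⊞⁺ˡ p∈A))
    ... | inj₁ p∈B = ⊥-elim (ℕ.<⇒≢ (ℕ.+-mono-<-≤ a<b (All.lookup B≤q p∈B)) a+p≡b+q)
    ... | inj₂ (r , r∈B , refl) =
      r , r∈B ,
      subst (_∈ y ∷ B) (ℕ.+-cancelˡ-≡ b q _ (trans (sym a+p≡b+q) (ℕ-+-left-comm a b r))) q∈B ,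
      p∈A

    -- The two exponents supplied by `bottom` already exhaust `B`.
    rhombus₂ : ∀ {A B} → length A ≡ 2 → length B ≡ 2 → a ⊞ A ≋ b ⊞ B → ∃ λ c → B ≋ a ⊞ [ c ]
    rhombus₂ {x ∷ A} _ ∣B∣≡2 eq with m , _ , _ , B′ , B≋ ← bottom eq
      with refl ← length-0 {xs = B′} (length-rest (m ∷ a ℕ.+ m ∷ []) B≋ ∣B∣≡2)
      = m , B≋

    -- Removing the parallelogram at `x` leaves two exponents in each list, the case of `rhombus₂`.
    rhombus₄-split : ∀ x {A A′ B B′} → length A ≡ 4 → length B ≡ 4 →
                     A ≋ x ∷ b ℕ.+ x ∷ A′ → B ≋ x ∷ a ℕ.+ x ∷ B′ →
                     a ⊞ A ≋ b ⊞ B → ∃₂ λ c d → B ≋ a ⊞ (c ∷ d ∷ [])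
    rhombus₄-split x {A′ = A′} {B′ = B′} ∣A∣≡4 ∣B∣≡4 A≋ B≋ eq
      with c , B′≋ ← rhombus₂ {A′} {B′} (length-rest (x ∷ b ℕ.+ x ∷ []) A≋ ∣A∣≡4)
                       (length-rest (x ∷ a ℕ.+ x ∷ []) B≋ ∣B∣≡4) (split-off x A≋ B≋ eq)
      = x , c , Bag.trans B≋ (Bag.trans (prep x (prep _ B′≋)) (Bag.↭-sym (⊞-∷ x [ c ])))

    -- The exceptional case `r = a + m`

    module _ (0<a : 0 < a) where

      private
        x<a+x : ∀ x → x < a ℕ.+ x
        x<a+x x = ℕ.m<n+m x 0<a

      -- m, a + m, s, … form a cycle alternating three steps of a and three of b, whence b = 3a;
      -- the remaining exponents t, a + t, w, b + w cannot match.
      hexagon : ∀ {m s t w} → a ℕ.+ s ≡ b ℕ.+ m → s ≡ a ℕ.+ (a ℕ.+ m) →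
        a ⊞ (m ∷ s ∷ b ℕ.+ (a ℕ.+ m) ∷ t ∷ []) ≋ b ⊞ (m ∷ a ℕ.+ m ∷ s ∷ w ∷ []) → ⊥
      hexagon {t = t} {w} a+s≡b+m s≡2a+m eq = [ parallel , crossed ]′
        (pair-inv (hexagon-rest a+s≡b+m s≡2a+m eq))
        where
        parallel : t ≡ w × a ℕ.+ t ≡ b ℕ.+ w → ⊥
        parallel (refl , a+t≡b+t) = ℕ.<⇒≢ (ℕ.+-monoˡ-< t a<b) a+t≡b+t
        crossed : t ≡ b ℕ.+ w × a ℕ.+ t ≡ w → ⊥
        crossed (refl , a+b+w≡w) = ℕ.<⇒≢ (ℕ.<-trans (x<b+x w) (x<a+x (b ℕ.+ w))) (sym a+b+w≡w)

      -- As for hexagon, but the cycle has four steps of each kind, whence b = 2a.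
      octagon : ∀ {m s w} → a ℕ.+ s ≡ b ℕ.+ m →
        a ⊞ (m ∷ s ∷ a ℕ.+ (a ℕ.+ m) ∷ b ℕ.+ (a ℕ.+ m) ∷ []) ≋
          b ⊞ (m ∷ a ℕ.+ m ∷ a ℕ.+ (a ℕ.+ m) ∷ w ∷ []) →
        s ≡ a ℕ.+ m
      octagon {m} {s} {w} a+s≡b+m eq = [ parallel , crossed ]′
        (pair-inv (octagon-rest a+s≡b+m eq))
        where
        parallel : s ≡ w × a ℕ.+ (a ℕ.+ (a ℕ.+ m)) ≡ b ℕ.+ w → s ≡ a ℕ.+ m
        parallel (refl , 3a+m≡b+s) = ℕ.+-cancelˡ-≡ a s (a ℕ.+ m) (begin
          a ℕ.+ s          ≡⟨ a+s≡b+m ⟩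
          b ℕ.+ m          ≡⟨ cong (ℕ._+ m) (octagon-b≡2a a+s≡b+m 3a+m≡b+s) ⟩
          a ℕ.+ a ℕ.+ m    ≡⟨ ℕ.+-assoc a a m ⟩
          a ℕ.+ (a ℕ.+ m)  ∎)
          where open ≡-Reasoning
        crossed : s ≡ b ℕ.+ w × a ℕ.+ (a ℕ.+ (a ℕ.+ m)) ≡ w → s ≡ a ℕ.+ m
        crossed (refl , refl) = ⊥-elim (ℕ.<⇒≢ (begin-strict
          b ℕ.+ m  <⟨ ℕ.+-monoʳ-< b (ℕ.<-trans (x<a+x m) (ℕ.<-trans (x<a+x _) (x<a+x _))) ⟩
          b ℕ.+ w  <⟨ x<a+x _ ⟩
          a ℕ.+ s  ∎) (sym a+s≡b+m))
          where open ℕ.≤-Reasoning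

      module _ {m s : ℕ} (a+s≡b+m : a ℕ.+ s ≡ b ℕ.+ m) where

        private
          -- For `r = a + m` these are the exponents `b + r` and `a + r` supplied by `top`.
          p = b ℕ.+ (a ℕ.+ m)
          q = a ℕ.+ (a ℕ.+ m)

          m<q : m < q
          m<q = ℕ.<-trans (x<a+x m) (x<a+x _)

          m<p : m < p
          m<p = ℕ.<-trans (x<a+x m) (x<b+x _)

          m<s : m < s
          m<s = ℕ.+-cancelˡ-< a m s
            (ℕ.<-≤-trans (ℕ.+-monoˡ-< m a<b) (ℕ.≤-reflexive (sym a+s≡b+m)))

          s<p : s < p
          s<p = ℕ.<-trans (x<a+x s)
            (ℕ.≤-<-trans (ℕ.≤-reflexive a+s≡b+m) (ℕ.+-monoʳ-< b (x<a+x m)))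

        -- Among `m`, `s`, `q`, `p` only `s` and `q` can coincide. If they do, `A` has one further
        -- exponent and `hexagon` gives a contradiction; if not, the four make up `A` and `octagon`
        -- identifies `s` with `a + m`.
        middle∈A : ∀ {A B} → length A ≡ 4 → length B ≡ 4 → a ⊞ A ≋ b ⊞ B →
          m ∈ A → s ∈ A → q ∈ A → p ∈ A →
          m ∈ B → a ℕ.+ m ∈ B → q ∈ B →
          a ℕ.+ m ∈ A
        middle∈A {A} {B} ∣A∣≡4 ∣B∣≡4 eq m∈A s∈A q∈A p∈A m∈B a+m∈B q∈B
          with W , B≋ ← extract-unique
                 ((ℕ.<⇒≢ (x<a+x m) ∷ ℕ.<⇒≢ m<q ∷ []) ∷ (ℕ.<⇒≢ (x<a+x _) ∷ []) ∷ [] ∷ [])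
                 (m∈B ∷ a+m∈B ∷ q∈B ∷ [])
          with w , refl ← length-1 {xs = W} (length-rest (m ∷ a ℕ.+ m ∷ q ∷ []) B≋ ∣B∣≡4)
          with s ℕ.≟ q
        ... | yes s≡q
          with T , A≋ ← extract-unique
                 ((ℕ.<⇒≢ m<s ∷ ℕ.<⇒≢ m<p ∷ []) ∷ (ℕ.<⇒≢ s<p ∷ []) ∷ [] ∷ [])
                 (m∈A ∷ s∈A ∷ p∈A ∷ [])
          with t , refl ← length-1 {xs = T} (length-rest (m ∷ s ∷ p ∷ []) A≋ ∣A∣≡4)
          = ⊥-elim (hexagon a+s≡b+m s≡q (Bag.trans (⊞-resp-≋ (Bag.↭-sym A≋))
              (Bag.trans eq (subst (λ x → b ⊞ B ≋ b ⊞ (m ∷ a ℕ.+ m ∷ x ∷ w ∷ [])) (sym s≡q)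
                (⊞-resp-≋ B≋)))))
        ... | no s≢q
          with T , A≋ ← extract-unique
                 ((ℕ.<⇒≢ m<s ∷ ℕ.<⇒≢ m<q ∷ ℕ.<⇒≢ m<p ∷ []) ∷ (s≢q ∷ ℕ.<⇒≢ s<p ∷ [])
                   ∷ (ℕ.<⇒≢ (ℕ.+-monoˡ-< (a ℕ.+ m) a<b) ∷ []) ∷ [] ∷ [])
                 (m∈A ∷ s∈A ∷ q∈A ∷ p∈A ∷ [])
          with refl ← length-0 {xs = T} (length-rest (m ∷ s ∷ q ∷ p ∷ []) A≋ ∣A∣≡4)
          = subst (_∈ A) (octagon a+s≡b+m (Bag.trans (⊞-resp-≋ (Bag.↭-sym A≋))
              (Bag.trans eq (⊞-resp-≋ B≋)))) s∈A

    -- The inequalities make the four exponents distinct, so they fill `B`.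
    parallelogram : 0 < a → ∀ {m r B} → m < r → r ≢ a ℕ.+ m → length B ≡ 4 →
      m ∈ B → a ℕ.+ m ∈ B → r ∈ B → a ℕ.+ r ∈ B → B ≋ a ⊞ (m ∷ r ∷ [])
    parallelogram 0<a {m} {r} m<r r≢a+m ∣B∣≡4 m∈B a+m∈B r∈B a+r∈B
      with D , B≋ ← extract-unique
             ((ℕ.<⇒≢ (ℕ.m<n+m m 0<a) ∷ ℕ.<⇒≢ m<r ∷ ℕ.<⇒≢ (ℕ.<-≤-trans m<r (ℕ.m≤n+m r a)) ∷ []) ∷
              (≢-sym r≢a+m ∷ (λ a+m≡a+r → ℕ.<⇒≢ m<r (ℕ.+-cancelˡ-≡ a m r a+m≡a+r)) ∷ []) ∷
              (ℕ.<⇒≢ (ℕ.m<n+m r 0<a) ∷ []) ∷ [] ∷ [])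
             (m∈B ∷ a+m∈B ∷ r∈B ∷ a+r∈B ∷ [])
      with refl ← length-0 {xs = D} (length-rest (m ∷ a ℕ.+ m ∷ r ∷ a ℕ.+ r ∷ []) B≋ ∣B∣≡4)
      = Bag.trans B≋ (prep m (swap _ _ Bag.refl))

    -- Only `B` is described: the matching form of `A` follows later by cancelling 1 + Xᵃ. The
    -- exponent `b + m` of the right side lies either in `A`, giving a parallelogram at `m`, or is
    -- `a + s` with `s` in `A`, which opens the remaining cases.
    rhombus₄ : ∀ {A B} → length A ≡ 4 → length B ≡ 4 → a ⊞ A ≋ b ⊞ B →
               ∃₂ λ c d → B ≋ a ⊞ (c ∷ d ∷ [])
    rhombus₄ {A@(_ ∷ _)} {B} ∣A∣≡4 ∣B∣≡4 eq
      with m , m≤ , m∈A , B′ , B≋ ← bottom eq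
      with r , r∈B , a+r∈B , b+r∈A ← top eq
      with m∈B ← Bag.∈-resp-↭ (Bag.↭-sym B≋) (here refl)
      with ∈-⊞⁻ A (Bag.∈-resp-↭ (Bag.↭-sym eq) (∈-⊞⁺ʳ m∈B))
    ... | inj₁ b+m∈A
      with A′ , A≋ ← extract-unique ((ℕ.<⇒≢ (x<b+x _) ∷ []) ∷ [] ∷ []) (m∈A ∷ b+m∈A ∷ [])
      = rhombus₄-split m ∣A∣≡4 ∣B∣≡4 A≋ B≋ eq
    ... | inj₂ (s , s∈A , b+m≡a+s) with a ℕ.≟ 0 | r ∈? A | r ℕ.≟ a ℕ.+ m
    -- For `a = 0` the shifted copy is `A` again, so `b + m` lies in `A` after all.
    ... | yes refl | _ | _
      with A′ , A≋ ← extract-unique ((ℕ.<⇒≢ (x<b+x _) ∷ []) ∷ [] ∷ [])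
             (m∈A ∷ subst (_∈ A) (sym b+m≡a+s) s∈A ∷ [])
      = rhombus₄-split m ∣A∣≡4 ∣B∣≡4 A≋ B≋ eq
    -- With `r` in `A`, the exponents from `top` complete a parallelogram at `r`.
    ... | no a≢0 | yes r∈A | _
      with A′ , A≋ ← extract-unique ((ℕ.<⇒≢ (x<b+x _) ∷ []) ∷ [] ∷ []) (r∈A ∷ b+r∈A ∷ [])
      with B″ , B≋ ← extract-unique ((ℕ.<⇒≢ (ℕ.m<n+m r (ℕ.n≢0⇒n>0 a≢0)) ∷ []) ∷ [] ∷ [])
             (r∈B ∷ a+r∈B ∷ [])
      = rhombus₄-split r ∣A∣≡4 ∣B∣≡4 A≋ B≋ eq
    ... | no a≢0 | no r∉A | yes refl = ⊥-elim (r∉A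
      (middle∈A (ℕ.n≢0⇒n>0 a≢0) (sym b+m≡a+s) ∣A∣≡4 ∣B∣≡4 eq
        m∈A s∈A (∈-⊞⁻-∉ r∉A (Bag.∈-resp-↭ (Bag.↭-sym eq) (∈-⊞⁺ˡ a+r∈B))) b+r∈A m∈B r∈B a+r∈B))
    ... | no a≢0 | no r∉A | no r≢a+m =
      m , r , parallelogram (ℕ.n≢0⇒n>0 a≢0)
        -- `m` is a lower bound, and `r = m` is excluded because `m` lies in `A` and `r` does not.
        (ℕ.≤∧≢⇒< (m≤ (Bag.∈-resp-↭ (Bag.↭-sym eq) (∈-⊞⁺ˡ r∈B))) λ { refl → r∉A m∈A })
        r≢a+m ∣B∣≡4 m∈B (Bag.∈-resp-↭ (Bag.↭-sym B≋) (there (here refl))) r∈B a+r∈B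

-- A record, so that unification can recover p and q, which it cannot from the function type p ≈ q.
infix 4 _≃_

record _≃_ (p q : N₁) : Set where
  constructor ⟪_⟫
  field at : p ≈ q
open _≃_

≃-refl : ∀ {p} → p ≃ p
≃-refl .at i = refl

≃-sym : ∀ {p q} → p ≃ q → q ≃ p
≃-sym p≃q .at i = sym (p≃q .at i)

≃-trans : ∀ {p q r} → p ≃ q → q ≃ r → p ≃ r
≃-trans p≃q q≃r .at i = trans (p≃q .at i) (q≃r .at i)

≃-setoid : Setoid 0ℓ 0ℓ
≃-setoid = record
  { Carrier       = N₁
  ; _≈_           = _≃_
  ; isEquivalence = record { refl = ≃-refl ; sym = ≃-sym ; trans = ≃-trans }
  }

module ≃-Reasoning = SetoidReasoning ≃-setoid

-- The commutative semiring ℤ≥0[X]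

scale : ℕ → N₁ → N₁
scale a = map (a ℕ.*_)

coeff-+ : ∀ p q i → coeff (p + q) i ≡ coeff p i ℕ.+ coeff q i
coeff-+ []      q       i       = refl
coeff-+ (a ∷ p) []      i       = sym (ℕ.+-identityʳ _)
coeff-+ (a ∷ p) (b ∷ q) zero    = refl
coeff-+ (a ∷ p) (b ∷ q) (suc i) = coeff-+ p q i

coeff-scale : ∀ a p i → coeff (scale a p) i ≡ a ℕ.* coeff p i
coeff-scale a []      i       = sym (ℕ.*-zeroʳ a)
coeff-scale a (b ∷ p) zero    = refl
coeff-scale a (b ∷ p) (suc i) = coeff-scale a p i

∷-cong : ∀ {a b p q} → a ≡ b → p ≃ q → a ∷ p ≃ b ∷ q
∷-cong a≡b p≃q .at zero    = a≡b
∷-cong a≡b p≃q .at (suc i) = p≃q .at i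

scale-cong : ∀ a {p q} → p ≃ q → scale a p ≃ scale a q
scale-cong a {p} {q} p≃q .at i =
  trans (coeff-scale a p i) (trans (cong (a ℕ.*_) (p≃q .at i)) (sym (coeff-scale a q i)))

+-cong : ∀ {p p′ q q′} → p ≃ p′ → q ≃ q′ → p + q ≃ p′ + q′
+-cong {p} {p′} {q} {q′} p≃p′ q≃q′ .at i =
  trans (coeff-+ p q i) (trans (cong₂ ℕ._+_ (p≃p′ .at i) (q≃q′ .at i)) (sym (coeff-+ p′ q′ i)))

+-congˡ : ∀ p {q r} → q ≃ r → p + q ≃ p + r
+-congˡ p = +-cong (≃-refl {p})

+-comm : ∀ p q → p + q ≃ q + p
+-comm p q .at i = trans (coeff-+ p q i) (trans (ℕ.+-comm (coeff p i) _) (sym (coeff-+ q p i)))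

+-assoc : ∀ p q r → (p + q) + r ≃ p + (q + r)
+-assoc p q r .at i = begin
  coeff (p + q + r) i                        ≡⟨ coeff-+ (p + q) r i ⟩
  coeff (p + q) i ℕ.+ coeff r i              ≡⟨ cong (ℕ._+ _) (coeff-+ p q i) ⟩
  coeff p i ℕ.+ coeff q i ℕ.+ coeff r i      ≡⟨ ℕ.+-assoc (coeff p i) _ _ ⟩
  coeff p i ℕ.+ (coeff q i ℕ.+ coeff r i)    ≡⟨ cong (coeff p i ℕ.+_) (coeff-+ q r i) ⟨
  coeff p i ℕ.+ coeff (q + r) i              ≡⟨ coeff-+ p (q + r) i ⟨
  coeff (p + (q + r)) i                      ∎
  where open ≡-Reasoning

+-commutativeMonoid : CommutativeMonoid 0ℓ 0ℓ
+-commutativeMonoid = record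
  { isCommutativeMonoid = record
    { isMonoid = record
      { isSemigroup = record
        { isMagma = record { isEquivalence = Setoid.isEquivalence ≃-setoid ; ∙-cong = +-cong }
        ; assoc   = +-assoc
        }
      ; identity = (λ p → ≃-refl) , (λ p → +-comm p [])
      }
    ; comm = +-comm
    }
  }

open CommutativeSemigroupProperties
  (CommutativeMonoid.commutativeSemigroup +-commutativeMonoid) using ()
  renaming (interchange to +-interchange; x∙yz≈y∙xz to +-left-comm)

+-cancelˡ : ∀ p {q r} → p + q ≃ p + r → q ≃ r
+-cancelˡ p {q} {r} eq .at i = ℕ.+-cancelˡ-≡ (coeff p i) _ _
  (trans (sym (coeff-+ p q i)) (trans (eq .at i) (coeff-+ p r i)))

scale-+ : ∀ a p q → scale a (p + q) ≃ scale a p + scale a q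
scale-+ a p q .at i = begin
  coeff (scale a (p + q)) i                      ≡⟨ coeff-scale a (p + q) i ⟩
  a ℕ.* coeff (p + q) i                          ≡⟨ cong (a ℕ.*_) (coeff-+ p q i) ⟩
  a ℕ.* (coeff p i ℕ.+ coeff q i)                ≡⟨ ℕ.*-distribˡ-+ a (coeff p i) _ ⟩
  a ℕ.* coeff p i ℕ.+ a ℕ.* coeff q i            ≡⟨ cong₂ ℕ._+_ (coeff-scale a p i) (coeff-scale a q i) ⟨
  coeff (scale a p) i ℕ.+ coeff (scale a q) i    ≡⟨ coeff-+ (scale a p) (scale a q) i ⟨
  coeff (scale a p + scale a q) i                ∎
  where open ≡-Reasoning

+-scale : ∀ a b p → scale (a ℕ.+ b) p ≃ scale a p + scale b p
+-scale a b p .at i = begin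
  coeff (scale (a ℕ.+ b) p) i                    ≡⟨ coeff-scale (a ℕ.+ b) p i ⟩
  (a ℕ.+ b) ℕ.* coeff p i                        ≡⟨ ℕ.*-distribʳ-+ (coeff p i) a b ⟩
  a ℕ.* coeff p i ℕ.+ b ℕ.* coeff p i            ≡⟨ cong₂ ℕ._+_ (coeff-scale a p i) (coeff-scale b p i) ⟨
  coeff (scale a p) i ℕ.+ coeff (scale b p) i    ≡⟨ coeff-+ (scale a p) (scale b p) i ⟨
  coeff (scale a p + scale b p) i                ∎
  where open ≡-Reasoning

scale-scale : ∀ a b p → scale a (scale b p) ≃ scale (a ℕ.* b) p
scale-scale a b p .at i = begin
  coeff (scale a (scale b p)) i  ≡⟨ coeff-scale a (scale b p) i ⟩
  a ℕ.* coeff (scale b p) i      ≡⟨ cong (a ℕ.*_) (coeff-scale b p i) ⟩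
  a ℕ.* (b ℕ.* coeff p i)        ≡⟨ ℕ.*-assoc a b _ ⟨
  a ℕ.* b ℕ.* coeff p i          ≡⟨ coeff-scale (a ℕ.* b) p i ⟨
  coeff (scale (a ℕ.* b) p) i    ∎
  where open ≡-Reasoning

0∷[]≃[] : 0 ∷ [] ≃ []
0∷[]≃[] .at zero    = refl
0∷[]≃[] .at (suc i) = refl

-- The summand `scale 0 q` left by the definition is a list of zeros, equal to `[]` as a polynomial
-- but in general not as a list.
0∷-* : ∀ p q → (0 ∷ p) * q ≃ 0 ∷ p * q
0∷-* p q = +-cong {scale 0 q} {[]} ⟪ coeff-scale 0 q ⟫ ≃-refl

*-zeroʳ : ∀ p → p * [] ≃ []
*-zeroʳ []      = ≃-refl
*-zeroʳ (a ∷ p) = ≃-trans (∷-cong refl (*-zeroʳ p)) 0∷[]≃[]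

-- The defining recursion of `_*_` mirrored to the second factor, from which commutativity follows
-- by induction.
*-∷ : ∀ p b q → p * (b ∷ q) ≃ scale b p + (0 ∷ p * q)
*-∷ []      b q = ≃-sym 0∷[]≃[]
*-∷ (a ∷ p) b q = ∷-cong (cong (ℕ._+ 0) (ℕ.*-comm a b)) (begin
  scale a q + p * (b ∷ q)                 ≈⟨ +-congˡ (scale a q) (*-∷ p b q) ⟩
  scale a q + (scale b p + (0 ∷ p * q))   ≈⟨ +-left-comm (scale a q) (scale b p) (0 ∷ p * q) ⟩
  scale b p + (scale a q + (0 ∷ p * q))   ∎)
  where open ≃-Reasoning

*-congˡ : ∀ p {q r} → q ≃ r → p * q ≃ p * r
*-congˡ []      q≃r = ≃-refl
*-congˡ (a ∷ p) q≃r = +-cong (scale-cong a q≃r) (∷-cong refl (*-congˡ p q≃r))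

*-comm : ∀ p q → p * q ≃ q * p
*-comm []      q = ≃-sym (*-zeroʳ q)
*-comm (a ∷ p) q = begin
  scale a q + (0 ∷ p * q)  ≈⟨ +-congˡ (scale a q) (∷-cong refl (*-comm p q)) ⟩
  scale a q + (0 ∷ q * p)  ≈⟨ *-∷ q a p ⟨
  q * (a ∷ p)              ∎
  where open ≃-Reasoning

*-cong : ∀ {p p′ q q′} → p ≃ p′ → q ≃ q′ → p * q ≃ p′ * q′
*-cong {p} {p′} {q} {q′} p≃p′ q≃q′ = begin
  p * q    ≈⟨ *-comm p q ⟩
  q * p    ≈⟨ *-congˡ q p≃p′ ⟩
  q * p′   ≈⟨ *-comm q p′ ⟩
  p′ * q   ≈⟨ *-congˡ p′ q≃q′ ⟩
  p′ * q′  ∎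
  where open ≃-Reasoning

*-distribʳ-+ : ∀ r p q → (p + q) * r ≃ p * r + q * r
*-distribʳ-+ r []      q       = ≃-refl
*-distribʳ-+ r (a ∷ p) []      = +-comm [] ((a ∷ p) * r)
*-distribʳ-+ r (a ∷ p) (b ∷ q) = begin
  scale (a ℕ.+ b) r + (0 ∷ (p + q) * r)
    ≈⟨ +-cong (+-scale a b r) (∷-cong refl (*-distribʳ-+ r p q)) ⟩
  (scale a r + scale b r) + ((0 ∷ p * r) + (0 ∷ q * r))
    ≈⟨ +-interchange (scale a r) (scale b r) (0 ∷ p * r) (0 ∷ q * r) ⟩
  (scale a r + (0 ∷ p * r)) + (scale b r + (0 ∷ q * r)) ∎
  where open ≃-Reasoning

*-distribˡ-+ : ∀ r p q → r * (p + q) ≃ r * p + r * q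
*-distribˡ-+ r p q = begin
  r * (p + q)    ≈⟨ *-comm r (p + q) ⟩
  (p + q) * r    ≈⟨ *-distribʳ-+ r p q ⟩
  p * r + q * r  ≈⟨ +-cong (*-comm p r) (*-comm q r) ⟩
  r * p + r * q  ∎
  where open ≃-Reasoning

scale-* : ∀ a p q → scale a p * q ≃ scale a (p * q)
scale-* a []      q = ≃-refl
scale-* a (b ∷ p) q = begin
  scale (a ℕ.* b) q + (0 ∷ scale a p * q)
    ≈⟨ +-cong (≃-sym (scale-scale a b q)) (∷-cong refl (scale-* a p q)) ⟩
  scale a (scale b q) + (0 ∷ scale a (p * q))
    ≡⟨ cong (λ x → scale a (scale b q) + (x ∷ scale a (p * q))) (ℕ.*-zeroʳ a) ⟨
  scale a (scale b q) + scale a (0 ∷ p * q)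
    ≈⟨ scale-+ a (scale b q) (0 ∷ p * q) ⟨
  scale a (scale b q + (0 ∷ p * q)) ∎
  where open ≃-Reasoning

*-assoc : ∀ p q r → (p * q) * r ≃ p * (q * r)
*-assoc []      q r = ≃-refl
*-assoc (a ∷ p) q r = begin
  (scale a q + (0 ∷ p * q)) * r            ≈⟨ *-distribʳ-+ r (scale a q) (0 ∷ p * q) ⟩
  scale a q * r + (0 ∷ p * q) * r          ≈⟨ +-cong (scale-* a q r) (0∷-* (p * q) r) ⟩
  scale a (q * r) + (0 ∷ p * q * r)        ≈⟨ +-congˡ (scale a (q * r)) (∷-cong refl (*-assoc p q r)) ⟩
  scale a (q * r) + (0 ∷ p * (q * r))      ∎
  where open ≃-Reasoning

*-identityˡ : ∀ p → 1# * p ≃ p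
*-identityˡ p .at i = begin
  coeff (scale 1 p + (0 ∷ [])) i  ≡⟨ +-cong (≃-refl {scale 1 p}) 0∷[]≃[] .at i ⟩
  coeff (scale 1 p + []) i        ≡⟨ +-comm (scale 1 p) [] .at i ⟩
  coeff (scale 1 p) i             ≡⟨ coeff-scale 1 p i ⟩
  1 ℕ.* coeff p i                 ≡⟨ ℕ.*-identityˡ _ ⟩
  coeff p i                       ∎
  where open ≡-Reasoning

*-identityʳ : ∀ p → p * 1# ≃ p
*-identityʳ p = ≃-trans (*-comm p 1#) (*-identityˡ p)

*-commutativeMonoid : CommutativeMonoid 0ℓ 0ℓ
*-commutativeMonoid = record
  { isCommutativeMonoid = record
    { isMonoid = record
      { isSemigroup = record
        { isMagma = record { isEquivalence = Setoid.isEquivalence ≃-setoid ; ∙-cong = *-cong }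
        ; assoc   = *-assoc
        }
      ; identity = *-identityˡ , *-identityʳ
      }
    ; comm = *-comm
    }
  }

open CommutativeSemigroupProperties
  (CommutativeMonoid.commutativeSemigroup *-commutativeMonoid) using ()
  renaming (x∙yz≈y∙xz to *-left-comm)

-- Constant terms and cancellation

coeff-*-zero : ∀ p q → coeff (p * q) 0 ≡ coeff p 0 ℕ.* coeff q 0
coeff-*-zero []      q = refl
coeff-*-zero (a ∷ p) q = trans (coeff-+ (scale a q) (0 ∷ p * q) 0)
  (trans (ℕ.+-identityʳ _) (coeff-scale a q 0))

-- Splits `q` into its constant term and X times `drop 1 q`, so that cancellation can recurse on the
-- index of the coefficient.
coeff-*-suc : ∀ p q i → coeff (p * q) (suc i) ≡ coeff q 0 ℕ.* coeff p (suc i) ℕ.+ coeff (p * drop 1 q) i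
coeff-*-suc p q i = begin
  coeff (p * q) (suc i)                              ≡⟨ *-congˡ p (η q) .at (suc i) ⟩
  coeff (p * (coeff q 0 ∷ drop 1 q)) (suc i)         ≡⟨ *-∷ p (coeff q 0) (drop 1 q) .at (suc i) ⟩
  coeff (scale (coeff q 0) p + (0 ∷ p * drop 1 q)) (suc i)
    ≡⟨ coeff-+ (scale (coeff q 0) p) (0 ∷ p * drop 1 q) (suc i) ⟩
  coeff (scale (coeff q 0) p) (suc i) ℕ.+ coeff (p * drop 1 q) i
    ≡⟨ cong (ℕ._+ coeff (p * drop 1 q) i) (coeff-scale (coeff q 0) p (suc i)) ⟩
  coeff q 0 ℕ.* coeff p (suc i) ℕ.+ coeff (p * drop 1 q) i ∎
  where
  open ≡-Reasoning
  η : ∀ q → q ≃ coeff q 0 ∷ drop 1 q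
  η []      .at zero    = refl
  η []      .at (suc i) = refl
  η (a ∷ q) .at i       = refl

coeff-drop : ∀ p i → coeff (drop 1 p) i ≡ coeff p (suc i)
coeff-drop []      i = refl
coeff-drop (a ∷ p) i = refl

-- The constant terms of `q` and `r` agree because that of `p` is nonzero. Their contribution then
-- cancels from the higher coefficients, which leaves the same equation for `drop 1 q` and
-- `drop 1 r` with the index lowered by one.
*-cancelˡ : ∀ p {q r} → coeff p 0 ≢ 0 → p * q ≃ p * r → q ≃ r
*-cancelˡ p {q} {r} p₀≢0 eq .at zero = ℕ.*-cancelˡ-≡ _ _ (coeff p 0) {{ℕ.≢-nonZero p₀≢0}}
  (trans (sym (coeff-*-zero p q)) (trans (eq .at 0) (coeff-*-zero p r)))
*-cancelˡ p {q} {r} p₀≢0 eq .at (suc i) = trans (sym (coeff-drop q i)) (trans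
  (*-cancelˡ p {drop 1 q} {drop 1 r} p₀≢0 ⟪ drop-eq ⟫ .at i) (coeff-drop r i))
  where
  drop-eq : p * drop 1 q ≈ p * drop 1 r
  drop-eq j = ℕ.+-cancelˡ-≡ (coeff q 0 ℕ.* coeff p (suc j)) _ _ (begin
    coeff q 0 ℕ.* coeff p (suc j) ℕ.+ coeff (p * drop 1 q) j  ≡⟨ coeff-*-suc p q j ⟨
    coeff (p * q) (suc j)                                     ≡⟨ eq .at (suc j) ⟩
    coeff (p * r) (suc j)                                     ≡⟨ coeff-*-suc p r j ⟩
    coeff r 0 ℕ.* coeff p (suc j) ℕ.+ coeff (p * drop 1 r) j
      ≡⟨ cong (λ c → c ℕ.* coeff p (suc j) ℕ.+ coeff (p * drop 1 r) j) (*-cancelˡ p p₀≢0 eq .at 0) ⟨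
    coeff q 0 ℕ.* coeff p (suc j) ℕ.+ coeff (p * drop 1 r) j  ∎)
    where open ≡-Reasoning

-- Evaluation as a semiring homomorphism

eval-≈[] : ∀ p x → p ≈ [] → eval p x ≡ 0
eval-≈[] []      x p≈[] = refl
eval-≈[] (a ∷ p) x p≈[] =
  trans (cong₂ (λ a e → a ℕ.+ x ℕ.* e) (p≈[] 0) (eval-≈[] p x (p≈[] ∘ suc))) (ℕ.*-zeroʳ x)

eval-cong : ∀ p q x → p ≈ q → eval p x ≡ eval q x
eval-cong []      q       x p≈q = sym (eval-≈[] q x (sym ∘ p≈q))
eval-cong (a ∷ p) []      x p≈q = eval-≈[] (a ∷ p) x p≈q
eval-cong (a ∷ p) (b ∷ q) x p≈q =
  cong₂ (λ a e → a ℕ.+ x ℕ.* e) (p≈q 0) (eval-cong p q x (p≈q ∘ suc))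

eval-+ : ∀ p q x → eval (p + q) x ≡ eval p x ℕ.+ eval q x
eval-+ []      q       x = refl
eval-+ (a ∷ p) []      x = sym (ℕ.+-identityʳ _)
eval-+ (a ∷ p) (b ∷ q) x = begin
  a ℕ.+ b ℕ.+ x ℕ.* eval (p + q) x                        ≡⟨ cong (λ e → a ℕ.+ b ℕ.+ x ℕ.* e) (eval-+ p q x) ⟩
  a ℕ.+ b ℕ.+ x ℕ.* (eval p x ℕ.+ eval q x)               ≡⟨ cong (a ℕ.+ b ℕ.+_) (ℕ.*-distribˡ-+ x (eval p x) _) ⟩
  a ℕ.+ b ℕ.+ (x ℕ.* eval p x ℕ.+ x ℕ.* eval q x)         ≡⟨ ℕ-+-interchange a b _ _ ⟩
  a ℕ.+ x ℕ.* eval p x ℕ.+ (b ℕ.+ x ℕ.* eval q x)         ∎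
  where open ≡-Reasoning

eval-scale : ∀ a p x → eval (scale a p) x ≡ a ℕ.* eval p x
eval-scale a []      x = sym (ℕ.*-zeroʳ a)
eval-scale a (b ∷ p) x = begin
  a ℕ.* b ℕ.+ x ℕ.* eval (scale a p) x   ≡⟨ cong (λ e → a ℕ.* b ℕ.+ x ℕ.* e) (eval-scale a p x) ⟩
  a ℕ.* b ℕ.+ x ℕ.* (a ℕ.* eval p x)     ≡⟨ cong (a ℕ.* b ℕ.+_) (ℕ-*-left-comm x a _) ⟩
  a ℕ.* b ℕ.+ a ℕ.* (x ℕ.* eval p x)     ≡⟨ ℕ.*-distribˡ-+ a b _ ⟨
  a ℕ.* (b ℕ.+ x ℕ.* eval p x)           ∎
  where open ≡-Reasoning

eval-* : ∀ p q x → eval (p * q) x ≡ eval p x ℕ.* eval q x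
eval-* []      q x = refl
eval-* (a ∷ p) q x = begin
  eval (scale a q + (0 ∷ p * q)) x                 ≡⟨ eval-+ (scale a q) (0 ∷ p * q) x ⟩
  eval (scale a q) x ℕ.+ x ℕ.* eval (p * q) x
    ≡⟨ cong₂ (λ e f → e ℕ.+ x ℕ.* f) (eval-scale a q x) (eval-* p q x) ⟩
  a ℕ.* eval q x ℕ.+ x ℕ.* (eval p x ℕ.* eval q x) ≡⟨ cong (a ℕ.* eval q x ℕ.+_) (ℕ.*-assoc x _ _) ⟨
  a ℕ.* eval q x ℕ.+ x ℕ.* eval p x ℕ.* eval q x   ≡⟨ ℕ.*-distribʳ-+ (eval q x) a _ ⟨
  (a ℕ.+ x ℕ.* eval p x) ℕ.* eval q x              ∎
  where open ≡-Reasoning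

-- Polynomials as multisets of exponents

infix 8 X^_ 1+X^_

X^_ : ℕ → N₁
X^ zero  = 1#
X^ suc e = 0 ∷ X^ e

poly : List ℕ → N₁
poly = foldr (λ e p → X^ e + p) []

coeff-X^-self : ∀ e → coeff (X^ e) e ≡ 1
coeff-X^-self zero    = refl
coeff-X^-self (suc e) = coeff-X^-self e

coeff-X^-≢0 : ∀ e k → coeff (X^ e) k ≢ 0 → k ≡ e
coeff-X^-≢0 zero    zero    _  = refl
coeff-X^-≢0 zero    (suc k) ≢0 = ⊥-elim (≢0 refl)
coeff-X^-≢0 (suc e) zero    ≢0 = ⊥-elim (≢0 refl)
coeff-X^-≢0 (suc e) (suc k) ≢0 = cong suc (coeff-X^-≢0 e k ≢0)

coeff-poly-≢0 : ∀ es k → coeff (poly es) k ≢ 0 → k ∈ es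
coeff-poly-≢0 []       k ≢0 = ⊥-elim (≢0 refl)
coeff-poly-≢0 (e ∷ es) k ≢0 with coeff (X^ e) k ℕ.≟ 0
... | no  ≢0′ = here (coeff-X^-≢0 e k ≢0′)
... | yes ≡0  = there (coeff-poly-≢0 es k λ ≡0′ →
  ≢0 (trans (coeff-+ (X^ e) (poly es) k) (cong₂ ℕ._+_ ≡0 ≡0′)))

poly-resp-≋ : ∀ {es fs} → es ≋ fs → poly es ≃ poly fs
poly-resp-≋ Bag.refl = ≃-refl
poly-resp-≋ (prep e es≋fs) = +-congˡ (X^ e) (poly-resp-≋ es≋fs)
poly-resp-≋ (swap {xs = es} e f es≋fs) = ≃-trans (+-left-comm (X^ e) (X^ f) (poly es))
  (+-congˡ (X^ f) (+-congˡ (X^ e) (poly-resp-≋ es≋fs)))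
poly-resp-≋ (Bag.trans es≋gs gs≋fs) = ≃-trans (poly-resp-≋ es≋gs) (poly-resp-≋ gs≋fs)

coeff-poly-∷ : ∀ e es → coeff (poly (e ∷ es)) e ≡ suc (coeff (poly es) e)
coeff-poly-∷ e es = trans (coeff-+ (X^ e) (poly es) e)
  (cong (ℕ._+ coeff (poly es) e) (coeff-X^-self e))

-- The first exponent `e` has a positive coefficient, so it also occurs in `fs`; removing it there
-- and cancelling `X^ e` leaves shorter lists. Equations between polynomials thus become equations
-- between multisets.
poly-injective : ∀ es fs → poly es ≃ poly fs → es ≋ fs
poly-injective []       []       _  = Bag.refl
poly-injective []       (f ∷ fs) eq with () ← trans (eq .at f) (coeff-poly-∷ f fs)
poly-injective (e ∷ es) fs       eq
  with fs′ , fs≋ ← extract (coeff-poly-≢0 fs e λ ≡0 →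
         ℕ.1+n≢0 (trans (sym (coeff-poly-∷ e es)) (trans (eq .at e) ≡0)))
  = Bag.trans (prep e (poly-injective es fs′
      (+-cancelˡ (X^ e) (≃-trans eq (poly-resp-≋ fs≋))))) (Bag.↭-sym fs≋)

poly-++ : ∀ es fs → poly (es ++ fs) ≃ poly es + poly fs
poly-++ []       fs = ≃-refl
poly-++ (e ∷ es) fs = ≃-trans (+-congˡ (X^ e) (poly-++ es fs))
  (≃-sym (+-assoc (X^ e) (poly es) (poly fs)))

X^-+ : ∀ d e → X^ (d ℕ.+ e) ≃ X^ d * X^ e
X^-+ zero    e = ≃-sym (*-identityˡ (X^ e))
X^-+ (suc d) e = ≃-trans (∷-cong refl (X^-+ d e))
  (≃-sym (0∷-* (X^ d) (X^ e)))

poly-shift : ∀ d es → poly (map (d ℕ.+_) es) ≃ X^ d * poly es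
poly-shift d []       = ≃-sym (*-zeroʳ (X^ d))
poly-shift d (e ∷ es) = begin
  X^ (d ℕ.+ e) + poly (map (d ℕ.+_) es)  ≈⟨ +-cong (X^-+ d e) (poly-shift d es) ⟩
  X^ d * X^ e + X^ d * poly es           ≈⟨ *-distribˡ-+ (X^ d) (X^ e) (poly es) ⟨
  X^ d * (X^ e + poly es)                ∎
  where open ≃-Reasoning

-- The case `a = 0` is included and gives the constant 2.
1+X^_ : ℕ → N₁
1+X^ a = poly (0 ∷ a ∷ [])

poly-⊞ : ∀ a es → poly (a ⊞ es) ≃ 1+X^ a * poly es
poly-⊞ a es = begin
  poly (es ++ map (a ℕ.+_) es)           ≈⟨ poly-++ es _ ⟩
  poly es + poly (map (a ℕ.+_) es)       ≈⟨ +-cong (≃-sym (*-identityˡ (poly es))) (poly-shift a es) ⟩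
  1# * poly es + X^ a * poly es          ≈⟨ *-distribʳ-+ (poly es) 1# (X^ a) ⟨
  (1# + X^ a) * poly es                  ≈⟨ *-cong (+-congˡ 1# (+-comm [] (X^ a))) ≃-refl ⟩
  1+X^ a * poly es                       ∎
  where open ≃-Reasoning

-- Horner's scheme: the exponents of the tail are raised by one, then `0` is added as often as the
-- constant term says.
exponents : ∀ p → ∃ λ es → p ≃ poly es
exponents []      = [] , ≃-refl
exponents (a ∷ p) = add-constant a
  where
  add-constant : ∀ a → ∃ λ es → a ∷ p ≃ poly es
  add-constant zero with es , p≃ ← exponents p = map suc es ,
    (begin
      0 ∷ p                ≈⟨ ∷-cong refl p≃ ⟩
      0 ∷ poly es          ≈⟨ ∷-cong refl (*-identityˡ (poly es)) ⟨
      0 ∷ 1# * poly es     ≈⟨ 0∷-* 1# (poly es) ⟨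
      X^ 1 * poly es       ≈⟨ poly-shift 1 es ⟨
      poly (map suc es)    ∎)
    where open ≃-Reasoning
  add-constant (suc a) with es , a∷p≃ ← add-constant a =
    0 ∷ es , +-congˡ 1# a∷p≃

eval-X^ : ∀ e → eval (X^ e) 1 ≡ 1
eval-X^ zero    = refl
eval-X^ (suc e) = trans (ℕ.+-identityʳ _) (eval-X^ e)

eval-poly : ∀ es → eval (poly es) 1 ≡ length es
eval-poly []       = refl
eval-poly (e ∷ es) = trans (eval-+ (X^ e) (poly es) 1) (cong₂ ℕ._+_ (eval-X^ e) (eval-poly es))

-- Factorisations into irreducibles

open Irreducible

1+X^-≢0 : ∀ a → coeff (1+X^ a) 0 ≢ 0
1+X^-≢0 zero    ()
1+X^-≢0 (suc a) ()

coeff-*-≢0 : ∀ p q → coeff (p * q) 0 ≢ 0 → coeff p 0 ≢ 0 × coeff q 0 ≢ 0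
coeff-*-≢0 p q ≢0 =
  (λ p₀≡0 → ≢0 (trans (coeff-*-zero p q) (cong (ℕ._* coeff q 0) p₀≡0))) ,
  (λ q₀≡0 → ≢0 (trans (coeff-*-zero p q) (trans (cong (coeff p 0 ℕ.*_) q₀≡0) (ℕ.*-zeroʳ (coeff p 0)))))

exponents-of-length : ∀ p {n} → eval p 1 ≡ n → ∃ λ es → length es ≡ n × p ≃ poly es
exponents-of-length p p₁≡n with es , p≃ ← exponents p =
  es , trans (sym (eval-poly es)) (trans (sym (eval-cong p (poly es) 1 (p≃ .at))) p₁≡n) , p≃

eval≢0 : ∀ p → coeff p 0 ≢ 0 → eval p 1 ≢ 0
eval≢0 p p₀≢0 p₁≡0 with [] , refl , p≃ ← exponents-of-length p p₁≡0 = p₀≢0 (p≃ .at 0)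

0∈exponents : ∀ p es → coeff p 0 ≢ 0 → p ≃ poly es → 0 ∈ es
0∈exponents p es p₀≢0 p≃ = coeff-poly-≢0 es 0 (λ ≡0 → p₀≢0 (trans (p≃ .at 0) ≡0))

-- The only exponent has to be `0`, as the constant term is nonzero.
eval≡1⇒≃1 : ∀ p → coeff p 0 ≢ 0 → eval p 1 ≡ 1 → p ≃ 1#
eval≡1⇒≃1 p p₀≢0 p₁≡1
  with e ∷ [] , refl , p≃ ← exponents-of-length p p₁≡1
  with here refl ← 0∈exponents p (e ∷ []) p₀≢0 p≃ = p≃

eval≡2⇒≃1+X^ : ∀ p → coeff p 0 ≢ 0 → eval p 1 ≡ 2 → ∃ λ a → p ≃ 1+X^ a
eval≡2⇒≃1+X^ p p₀≢0 p₁≡2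
  with e ∷ f ∷ [] , refl , p≃ ← exponents-of-length p p₁≡2
  with 0∈exponents p (e ∷ f ∷ []) p₀≢0 p≃
... | here refl         = f , p≃
... | there (here refl) = e , ≃-trans p≃ (poly-resp-≋ {e ∷ 0 ∷ []} {0 ∷ e ∷ []} (swap e 0 Bag.refl))

m*n≡2⇒m≡1⊎n≡1 : ∀ m n → m ℕ.* n ≡ 2 → m ≡ 1 ⊎ n ≡ 1
m*n≡2⇒m≡1⊎n≡1 1             n             _  = inj₁ refl
m*n≡2⇒m≡1⊎n≡1 (suc (suc m)) 1             _  = inj₂ refl
m*n≡2⇒m≡1⊎n≡1 (suc (suc m)) 0             eq with () ← trans (sym (ℕ.*-zeroʳ m)) eq
m*n≡2⇒m≡1⊎n≡1 (suc (suc m)) (suc (suc n)) eq =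
  ⊥-elim (ℕ.<⇒≢ (ℕ.<-≤-trans (s≤s (s≤s (s≤s z≤n)))
    (ℕ.*-mono-≤ {2} {suc (suc m)} {2} {suc (suc n)} (s≤s (s≤s z≤n)) (s≤s (s≤s z≤n)))) (sym eq))

-- The values of two factors at 1 multiply to 2, so one of them is 1; a nonzero constant term,
-- inherited from `p`, then makes that factor `1#`.
eval≡2⇒irreducible : ∀ p → coeff p 0 ≢ 0 → eval p 1 ≡ 2 → Irreducible p
eval≡2⇒irreducible p p₀≢0 p₁≡2 .≉0 p≈0 = p₀≢0 (p≈0 0)
eval≡2⇒irreducible p p₀≢0 p₁≡2 .≉1 p≈1 with () ← trans (sym p₁≡2) (eval-cong p 1# 1 p≈1)
eval≡2⇒irreducible p p₀≢0 p₁≡2 .split S T p≈ST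
  with S₀≢0 , T₀≢0 ← coeff-*-≢0 S T (λ ≡0 → p₀≢0 (trans (p≈ST 0) ≡0))
  = Sum.map (at ∘ eval≡1⇒≃1 S S₀≢0) (at ∘ eval≡1⇒≃1 T T₀≢0)
      (m*n≡2⇒m≡1⊎n≡1 (eval S 1) (eval T 1)
        (trans (sym (eval-* S T 1)) (trans (sym (eval-cong p (S * T) 1 p≈ST)) p₁≡2)))

-- Supplies irreducible factors of a common cofactor, which has one or two monomials and so is `1#`
-- or itself irreducible.
factorise-small : ∀ p → coeff p 0 ≢ 0 → eval p 1 ≡ 1 ⊎ eval p 1 ≡ 2 →
                  ∃ λ Cs → All Irreducible Cs × p ≃ product Cs
factorise-small p p₀≢0 (inj₁ p₁≡1) = [] , [] , eval≡1⇒≃1 p p₀≢0 p₁≡1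
factorise-small p p₀≢0 (inj₂ p₁≡2) =
  p ∷ [] , eval≡2⇒irreducible p p₀≢0 p₁≡2 ∷ [] , ≃-sym (*-identityʳ p)

*-exponents : ∀ a p es → p ≃ poly es → 1+X^ a * p ≃ poly (a ⊞ es)
*-exponents a p es p≃ = ≃-trans (*-congˡ (1+X^ a) p≃) (≃-sym (poly-⊞ a es))

-- Common cofactors of two binomials

module _ {a b : ℕ} (a<b : a < b) where

  -- For `n = 0` there is no solution, because `bottom` finds two exponents in `B`; the other sizes
  -- are `rhombus₂` and `rhombus₄`.
  cofactor-exponents : ∀ n → n ≤ 2 → ∀ A B → length A ≡ 2 ℕ.^ n → length B ≡ 2 ℕ.^ n →
    a ⊞ A ≋ b ⊞ B → ∃ λ C → (length C ≡ 1 ⊎ length C ≡ 2) × B ≋ a ⊞ C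
  cofactor-exponents 0 _ (x ∷ A) B _ ∣B∣≡1 eq with m , _ , _ , B′ , B≋ ← bottom a<b {x} {A} {B} eq
    with () ← trans (sym (Bag.↭-length B≋)) ∣B∣≡1
  cofactor-exponents 1 _ A B ∣A∣≡2 ∣B∣≡2 eq with c , B≋ ← rhombus₂ a<b {A} {B} ∣A∣≡2 ∣B∣≡2 eq =
    c ∷ [] , inj₁ refl , B≋
  cofactor-exponents 2 _ A B ∣A∣≡4 ∣B∣≡4 eq with c , d , B≋ ← rhombus₄ a<b {A} {B} ∣A∣≡4 ∣B∣≡4 eq =
    c ∷ d ∷ [] , inj₂ refl , B≋
  cofactor-exponents (suc (suc (suc n))) (s≤s (s≤s ()))

  -- The form of `B` is read off from its exponents; that of `A` follows by cancelling 1 + Xᵃ from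
  -- (1 + Xᵃ) A = (1 + Xᵇ)(1 + Xᵃ) C.
  common-cofactor : ∀ n → n ≤ 2 → ∀ A B → eval A 1 ≡ 2 ℕ.^ n → eval B 1 ≡ 2 ℕ.^ n →
    1+X^ a * A ≃ 1+X^ b * B →
    ∃ λ C → A ≃ 1+X^ b * C × B ≃ 1+X^ a * C × (eval C 1 ≡ 1 ⊎ eval C 1 ≡ 2)
  common-cofactor n n≤2 A B A₁≡ B₁≡ eq
    with as , ∣as∣≡ , A≃ ← exponents-of-length A A₁≡
    with bs , ∣bs∣≡ , B≃ ← exponents-of-length B B₁≡
    with cs , ∣cs∣≡ , bs≋ ← cofactor-exponents n n≤2 as bs ∣as∣≡ ∣bs∣≡
           (poly-injective (a ⊞ as) (b ⊞ bs)
             (≃-trans (≃-sym (*-exponents a A as A≃)) (≃-trans eq (*-exponents b B bs B≃))))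
    = poly cs , *-cancelˡ (1+X^ a) (1+X^-≢0 a) (begin
        1+X^ a * A                   ≈⟨ eq ⟩
        1+X^ b * B                   ≈⟨ *-congˡ (1+X^ b) (B≃aC bs cs bs≋ B≃) ⟩
        1+X^ b * (1+X^ a * poly cs)  ≈⟨ *-left-comm (1+X^ b) (1+X^ a) (poly cs) ⟩
        1+X^ a * (1+X^ b * poly cs)  ∎) , B≃aC bs cs bs≋ B≃ ,
      Sum.map (trans (eval-poly cs)) (trans (eval-poly cs)) ∣cs∣≡
    where
    open ≃-Reasoning
    B≃aC : ∀ bs cs → bs ≋ a ⊞ cs → B ≃ poly bs → B ≃ 1+X^ a * poly cs
    B≃aC bs cs bs≋ B≃ = ≃-trans B≃ (≃-trans (poly-resp-≋ bs≋) (poly-⊞ a cs))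

pick : ∀ {p} {P : N₁ → Set p} {Qs} → All Irreducible Qs → Any P Qs →
       ∃₂ λ Q Qs′ → P Q × Irreducible Q × All Irreducible Qs′ ×
       Qs ↭ Q ∷ Qs′ × product Qs ≃ Q * product Qs′
pick {Qs = Q ∷ Qs} (Q-irr ∷ Qs-irr) (here PQ) =
  Q , Qs , PQ , Q-irr , Qs-irr , Perm.↭-refl , ≃-refl
pick {Qs = R ∷ Qs} (R-irr ∷ Qs-irr) (there PQs)
  with Q , Qs′ , PQ , Q-irr , Qs′-irr , Qs↭ , ΠQs≃ ← pick Qs-irr PQs =
  Q , R ∷ Qs′ , PQ , Q-irr , R-irr ∷ Qs′-irr ,
  Perm.↭-trans (Perm.↭-prep R Qs↭) (Perm.↭-swap R Q Perm.↭-refl) ,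
  ≃-trans (*-congˡ R ΠQs≃) (*-left-comm R Q (product Qs′))

irreducible-eval≥2 : ∀ Q → Irreducible Q → coeff Q 0 ≢ 0 → 2 ≤ eval Q 1
irreducible-eval≥2 Q Q-irr Q₀≢0 =
  ℕ.≤∧≢⇒< (ℕ.n≢0⇒n>0 (eval≢0 Q Q₀≢0)) (λ 1≡Q₁ → ≉1 Q-irr (eval≡1⇒≃1 Q Q₀≢0 (sym 1≡Q₁) .at))

-- A first factor would have value 1 at 1 and nonzero constant term, hence be `1#`, which is not
-- irreducible.
product≃1⇒[] : ∀ Qs → All Irreducible Qs → product Qs ≃ 1# → Qs ≡ []
product≃1⇒[] []       []               _   = refl
product≃1⇒[] (Q ∷ Qs) (Q-irr ∷ Qs-irr) Π≃1 = ⊥-elim (≉1 Q-irr (eval≡1⇒≃1 Q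
  (proj₁ (coeff-*-≢0 Q (product Qs) (λ ≡0 → ℕ.0≢1+n (trans (sym ≡0) (Π≃1 .at 0)))))
  (ℕ.m*n≡1⇒m≡1 (eval Q 1) (eval (product Qs) 1)
    (trans (sym (eval-* Q (product Qs) 1)) (eval-cong (Q * product Qs) 1# 1 (Π≃1 .at)))) .at))

irreducible-product : ∀ Q Rs → Irreducible Q → All Irreducible Rs → Q ≃ product Rs → Q ∷ [] ↭ Rs
irreducible-product Q []       Q-irr _ Q≃1 = ⊥-elim (≉1 Q-irr (Q≃1 .at))
irreducible-product Q (R ∷ Rs) Q-irr (R-irr ∷ Rs-irr) Q≃ with split Q-irr R (product Rs) (Q≃ .at)
... | inj₁ R≈1 = ⊥-elim (≉1 R-irr R≈1)
... | inj₂ Π≈1 with refl ← product≃1⇒[] Rs Rs-irr ⟪ Π≈1 ⟫ =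
  Perm.prep (≃-trans Q≃ (*-identityʳ R) .at) Perm.↭-refl

irreducible-eval≥3 : ∀ Q → Irreducible Q → coeff Q 0 ≢ 0 → eval Q 1 ≢ 2 → 3 ≤ eval Q 1
irreducible-eval≥3 Q Q-irr Q₀≢0 Q₁≢2 = ℕ.≤∧≢⇒< (irreducible-eval≥2 Q Q-irr Q₀≢0) (≢-sym Q₁≢2)

-- Otherwise the product would have at least 3 · 3 monomials.
has-binomial : ∀ Q Q′ Qs → All Irreducible (Q ∷ Q′ ∷ Qs) →
  coeff (product (Q ∷ Q′ ∷ Qs)) 0 ≢ 0 → eval (product (Q ∷ Q′ ∷ Qs)) 1 ≤ 8 →
  Any (λ R → eval R 1 ≡ 2) (Q ∷ Q′ ∷ Qs)
has-binomial Q Q′ Qs (Q-irr ∷ Q′-irr ∷ _) ≢0 ≤8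
  with Q₀≢0 , Π₀≢0 ← coeff-*-≢0 Q (product (Q′ ∷ Qs)) ≢0
  with Q′₀≢0 , Π′₀≢0 ← coeff-*-≢0 Q′ (product Qs) Π₀≢0
  with eval Q 1 ℕ.≟ 2 | eval Q′ 1 ℕ.≟ 2
... | yes Q₁≡2 | _         = here Q₁≡2
... | no  _    | yes Q′₁≡2 = there (here Q′₁≡2)
... | no Q₁≢2  | no Q′₁≢2  = ⊥-elim (ℕ.<⇒≱ (begin-strict
  8                 <⟨ ℕ.≤-refl ⟩
  3 ℕ.* (3 ℕ.* 1)   ≤⟨ ℕ.*-mono-≤ (irreducible-eval≥3 Q Q-irr Q₀≢0 Q₁≢2)
                        (ℕ.*-mono-≤ (irreducible-eval≥3 Q′ Q′-irr Q′₀≢0 Q′₁≢2)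
                          (ℕ.n≢0⇒n>0 (eval≢0 (product Qs) Π′₀≢0))) ⟩
  eval Q 1 ℕ.* (eval Q′ 1 ℕ.* eval (product Qs) 1)   ≡⟨ cong (eval Q 1 ℕ.*_) (eval-* Q′ (product Qs) 1) ⟨
  eval Q 1 ℕ.* eval (Q′ * product Qs) 1              ≡⟨ eval-* Q (Q′ * product Qs) 1 ⟨
  eval (Q * (Q′ * product Qs)) 1                     ∎) ≤8)
  where open ℕ.≤-Reasoning

-- Uniqueness for nonzero constant term

UniqueFactorisation : ℕ → Set
UniqueFactorisation n = ∀ Qs Rs → All Irreducible Qs → All Irreducible Rs →
  coeff (product Qs) 0 ≢ 0 → eval (product Qs) 1 ≡ 2 ℕ.^ n → product Qs ≃ product Rs → Qs ↭ Rs

-- With irreducible factors `Cs` of the common cofactor, the product of `Qs` is also that of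
-- `R ∷ Cs`, and the product of `Rs` that of `Q ∷ Cs`. Uniqueness for these smaller products turns
-- both sides into `Q`, `R` and `Cs`.
exchange : ∀ {n} → n ≤ 2 → UniqueFactorisation n → ∀ {a b} → a < b →
  ∀ {Q R Qs Rs} → Q ≃ 1+X^ a → R ≃ 1+X^ b → Irreducible Q → Irreducible R →
  All Irreducible Qs → All Irreducible Rs →
  coeff (product Qs) 0 ≢ 0 → eval (product Qs) 1 ≡ 2 ℕ.^ n →
  coeff (product Rs) 0 ≢ 0 → eval (product Rs) 1 ≡ 2 ℕ.^ n →
  Q * product Qs ≃ R * product Rs → Q ∷ Qs ↭ R ∷ Rs
exchange {n} n≤2 unique {a} {b} a<b {Q} {R} {Qs} {Rs} Q≃ R≃ Q-irr R-irr Qs-irr Rs-irr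
  A₀≢0 A₁≡ B₀≢0 B₁≡ eq
  with C , A≃bC , B≃aC , C₁≡ ← common-cofactor a<b n n≤2 (product Qs) (product Rs) A₁≡ B₁≡
         (≃-trans (*-cong (≃-sym Q≃) ≃-refl) (≃-trans eq (*-cong R≃ ≃-refl)))
  with Cs , Cs-irr , C≃ ← factorise-small C
         (proj₂ (coeff-*-≢0 (1+X^ b) C (λ ≡0 → A₀≢0 (trans (A≃bC .at 0) ≡0)))) C₁≡
  = begin
    Q ∷ Qs      ↭⟨ Perm.↭-prep Q (unique Qs (R ∷ Cs) Qs-irr (R-irr ∷ Cs-irr) A₀≢0 A₁≡
                     (≃-trans A≃bC (*-cong (≃-sym R≃) C≃))) ⟩
    Q ∷ R ∷ Cs  ↭⟨ Perm.↭-swap Q R Perm.↭-refl ⟩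
    R ∷ Q ∷ Cs  ↭⟨ Perm.↭-prep R (unique Rs (Q ∷ Cs) Rs-irr (Q-irr ∷ Cs-irr) B₀≢0 B₁≡
                     (≃-trans B≃aC (*-cong (≃-sym Q≃) C≃))) ⟨
    R ∷ Rs      ∎
  where open Perm.PermutationReasoning

eval-cofactor : ∀ Q A P n → eval Q 1 ≡ 2 → P ≃ Q * A → eval P 1 ≡ 2 ℕ.^ suc n → eval A 1 ≡ 2 ℕ.^ n
eval-cofactor Q A P n Q₁≡2 P≃ P₁≡ = ℕ.*-cancelˡ-≡ (eval A 1) (2 ℕ.^ n) 2 (begin
  2 ℕ.* eval A 1         ≡⟨ cong (ℕ._* eval A 1) Q₁≡2 ⟨
  eval Q 1 ℕ.* eval A 1  ≡⟨ eval-* Q A 1 ⟨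
  eval (Q * A) 1         ≡⟨ eval-cong P (Q * A) 1 (P≃ .at) ⟨
  eval P 1               ≡⟨ P₁≡ ⟩
  2 ℕ.* 2 ℕ.^ n          ∎)
  where open ≡-Reasoning

compare-binomials : ∀ {n} → n ≤ 2 → UniqueFactorisation n →
  ∀ {a b Q R Qs Rs} → Q ≃ 1+X^ a → R ≃ 1+X^ b → Irreducible Q → Irreducible R →
  All Irreducible Qs → All Irreducible Rs →
  coeff (product Qs) 0 ≢ 0 → eval (product Qs) 1 ≡ 2 ℕ.^ n →
  coeff (product Rs) 0 ≢ 0 → eval (product Rs) 1 ≡ 2 ℕ.^ n →
  Q * product Qs ≃ R * product Rs → Q ∷ Qs ↭ R ∷ Rs
compare-binomials n≤2 unique {a} {b} {Q} {R} {Qs} {Rs} Q≃ R≃ Q-irr R-irr Qs-irr Rs-irr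
  A₀≢0 A₁≡ B₀≢0 B₁≡ eq
  with ℕ.<-cmp a b
... | tri< a<b _ _ =
  exchange n≤2 unique {a} {b} a<b Q≃ R≃ Q-irr R-irr Qs-irr Rs-irr A₀≢0 A₁≡ B₀≢0 B₁≡ eq
... | tri> _ _ b<a = Perm.↭-sym
  (exchange n≤2 unique {b} {a} b<a R≃ Q≃ R-irr Q-irr Rs-irr Qs-irr B₀≢0 B₁≡ A₀≢0 A₁≡ (≃-sym eq))
-- Equal binomials cancel, and the cofactors are compared directly.
... | tri≈ _ refl _ = Perm.prep (Q≃R .at) (unique Qs Rs Qs-irr Rs-irr A₀≢0 A₁≡
  (*-cancelˡ Q (λ ≡0 → 1+X^-≢0 a (trans (sym (Q≃ .at 0)) ≡0)) (≃-trans eq (*-cong (≃-sym Q≃R) ≃-refl))))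
  where
  Q≃R : Q ≃ R
  Q≃R = ≃-trans Q≃ (≃-sym R≃)

-- Induction on the exponent of P(1) = 2ⁿ: a factor with two monomials halves the value. Sides with
-- at most one factor are settled by irreducibility; otherwise each side contains a binomial, which
-- is moved to the front for `compare-binomials`.
unique-factorisation : ∀ n → n ≤ 3 → UniqueFactorisation n
unique-factorisation zero _ Qs Rs Qs-irr Rs-irr P₀≢0 P₁≡1 eq
  with P≃1 ← eval≡1⇒≃1 (product Qs) P₀≢0 P₁≡1
  with refl ← product≃1⇒[] Qs Qs-irr P≃1
  with refl ← product≃1⇒[] Rs Rs-irr (≃-sym eq) = Perm.↭-refl
unique-factorisation (suc n) _ [] Rs _ Rs-irr _ _ eq
  with refl ← product≃1⇒[] Rs Rs-irr (≃-sym eq) = Perm.↭-refl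
unique-factorisation (suc n) _ (Q ∷ []) Rs (Q-irr ∷ []) Rs-irr _ _ eq =
  irreducible-product Q Rs Q-irr Rs-irr (≃-trans (≃-sym (*-identityʳ Q)) eq)
unique-factorisation (suc n) _ Qs@(_ ∷ _ ∷ _) [] Qs-irr _ _ _ eq
  with () ← product≃1⇒[] Qs Qs-irr eq
unique-factorisation (suc n) _ Qs@(_ ∷ _ ∷ _) (R ∷ []) Qs-irr (R-irr ∷ []) _ _ eq =
  Perm.↭-sym (irreducible-product R Qs R-irr Qs-irr (≃-trans (≃-sym (*-identityʳ R)) (≃-sym eq)))
unique-factorisation (suc n) (s≤s n≤2) Qs@(Q₁ ∷ Q₂ ∷ Qs₃) Rs@(R₁ ∷ R₂ ∷ Rs₃) Qs-irr Rs-irr P₀≢0 P₁≡ eq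
  -- The bound `suc n ≤ 3` keeps the value at most 2³ = 8, as `has-binomial` requires.
  with P₁≤8 ← ℕ.≤-trans (ℕ.≤-reflexive P₁≡) (ℕ.^-monoʳ-≤ 2 (s≤s n≤2))
  with P₁≡P₁′ ← eval-cong (product Qs) (product Rs) 1 (eq .at)
  with P₀′≢0 ← subst (_≢ 0) (eq .at 0) P₀≢0
  with Q , Qs′ , Q₁≡2 , Q-irr , Qs′-irr , Qs↭ , ΠQs≃
       ← pick Qs-irr (has-binomial Q₁ Q₂ Qs₃ Qs-irr P₀≢0 P₁≤8)
  with R , Rs′ , R₁≡2 , R-irr , Rs′-irr , Rs↭ , ΠRs≃
       ← pick Rs-irr (has-binomial R₁ R₂ Rs₃ Rs-irr P₀′≢0 (subst (_≤ 8) P₁≡P₁′ P₁≤8))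
  with Q₀≢0 , A₀≢0 ← coeff-*-≢0 Q (product Qs′) (subst (_≢ 0) (ΠQs≃ .at 0) P₀≢0)
  with R₀≢0 , B₀≢0 ← coeff-*-≢0 R (product Rs′) (subst (_≢ 0) (ΠRs≃ .at 0) P₀′≢0)
  with a , Q≃ ← eval≡2⇒≃1+X^ Q Q₀≢0 Q₁≡2
  with b , R≃ ← eval≡2⇒≃1+X^ R R₀≢0 R₁≡2
  = Perm.↭-trans Qs↭ (Perm.↭-trans
      (compare-binomials n≤2 (unique-factorisation n (ℕ.m≤n⇒m≤1+n n≤2)) {a} {b} Q≃ R≃
        Q-irr R-irr Qs′-irr Rs′-irr
        A₀≢0 (eval-cofactor Q (product Qs′) (product Qs) n Q₁≡2 ΠQs≃ P₁≡)
        B₀≢0 (eval-cofactor R (product Rs′) (product Rs) n R₁≡2 ΠRs≃ (trans (sym P₁≡P₁′) P₁≡))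
        (≃-trans (≃-sym ΠQs≃) (≃-trans eq ΠRs≃)))
      (Perm.↭-sym Rs↭))

-- Removing the powers of X

X∣irreducible : ∀ Q → Irreducible Q → coeff Q 0 ≡ 0 → Q ≃ X^ 1
X∣irreducible []      Q-irr _    = ⊥-elim (≉0 Q-irr (λ _ → refl))
X∣irreducible (0 ∷ Q) Q-irr refl
  with split Q-irr (X^ 1) Q (≃-sym (≃-trans (0∷-* 1# Q) (∷-cong refl (*-identityˡ Q))) .at)
... | inj₁ X≈1 with () ← X≈1 0
... | inj₂ Q≈1 = ∷-cong refl ⟪ Q≈1 ⟫

-- An irreducible factor with zero constant term is X itself. The constant terms of the others are
-- nonzero naturals, so their product is nonzero too.
strip-X : ∀ Qs → All Irreducible Qs → ∃₂ λ k Qs′ → All Irreducible Qs′ ×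
  Qs ↭ replicate k (X^ 1) ++ Qs′ × product Qs ≃ X^ k * product Qs′ × coeff (product Qs′) 0 ≢ 0
strip-X [] [] = 0 , [] , [] , Perm.↭-refl , ≃-sym (*-identityˡ 1#) , λ ()
strip-X (Q ∷ Qs) (Q-irr ∷ Qs-irr)
  with k , Qs′ , Qs′-irr , Qs↭ , ΠQs≃ , Π₀≢0 ← strip-X Qs Qs-irr
  with coeff Q 0 ℕ.≟ 0
... | yes Q₀≡0 = suc k , Qs′ , Qs′-irr , Perm.prep (X∣irreducible Q Q-irr Q₀≡0 .at) Qs↭ , (begin
    Q * product Qs                 ≈⟨ *-cong (X∣irreducible Q Q-irr Q₀≡0) ΠQs≃ ⟩
    X^ 1 * (X^ k * product Qs′)    ≈⟨ *-assoc (X^ 1) (X^ k) (product Qs′) ⟨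
    X^ 1 * X^ k * product Qs′      ≈⟨ *-cong (X^-+ 1 k) ≃-refl ⟨
    X^ suc k * product Qs′         ∎) , Π₀≢0
  where open ≃-Reasoning
... | no  Q₀≢0 = k , Q ∷ Qs′ , Q-irr ∷ Qs′-irr ,
    Perm.↭-trans (Perm.↭-prep Q Qs↭) (Perm.↭-sym (Permₚ.↭-shift (replicate k (X^ 1)) Qs′)) ,
    ≃-trans (*-congˡ Q ΠQs≃) (*-left-comm Q (X^ k) (product Qs′)) ,
    λ ≡0 → [ Q₀≢0 , Π₀≢0 ]′ (ℕ.m*n≡0⇒m≡0∨n≡0 (coeff Q 0)
      (trans (sym (coeff-*-zero Q (product Qs′))) ≡0))

-- X is cancelled from both sides while both powers are positive; if only one is exhausted,
-- comparing constant terms gives a contradiction.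
X^-*-injective : ∀ k l {p q} → coeff p 0 ≢ 0 → coeff q 0 ≢ 0 → X^ k * p ≃ X^ l * q → k ≡ l × p ≃ q
X^-*-injective zero    zero    {p} {q} _ _ eq =
  refl , ≃-trans (≃-sym (*-identityˡ p)) (≃-trans eq (*-identityˡ q))
X^-*-injective zero    (suc l) {p} {q} p₀≢0 _ eq = ⊥-elim (p₀≢0
  (trans (sym (*-identityˡ p .at 0)) (trans (eq .at 0) (coeff-*-zero (X^ suc l) q))))
X^-*-injective (suc k) zero    {p} {q} _ q₀≢0 eq = ⊥-elim (q₀≢0
  (trans (sym (*-identityˡ q .at 0)) (trans (sym (eq .at 0)) (coeff-*-zero (X^ suc k) p))))
X^-*-injective (suc k) (suc l) {p} {q} p₀≢0 q₀≢0 eq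
  with refl , p≃q ← X^-*-injective k l p₀≢0 q₀≢0
    ⟪ (λ i → at (≃-trans (≃-sym (0∷-* (X^ k) p)) (≃-trans eq (0∷-* (X^ l) q))) (suc i)) ⟫ = refl , p≃q

eval-X^-* : ∀ k p → eval (X^ k * p) 1 ≡ eval p 1
eval-X^-* k p = trans (eval-* (X^ k) p 1)
  (trans (cong (ℕ._* eval p 1) (eval-X^ k)) (ℕ.*-identityˡ (eval p 1)))

mainTheorem10 : (P : N₁) → eval P 1 ≡ 8 →
    (Qs Rs : List N₁) → All Irreducible Qs → All Irreducible Rs →
    P ≈ product Qs → P ≈ product Rs → Qs ↭ Rs
mainTheorem10 P P₁≡8 Qs Rs Qs-irr Rs-irr P≈ΠQs P≈ΠRs
  with k , Qs′ , Qs′-irr , Qs↭ , ΠQs≃ , A₀≢0 ← strip-X Qs Qs-irr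
  with l , Rs′ , Rs′-irr , Rs↭ , ΠRs≃ , B₀≢0 ← strip-X Rs Rs-irr
  -- Both `k` and `l` are the order of vanishing of `P` at 0, so the two sides contain equally many
  -- copies of X.
  with refl , A≃B ← X^-*-injective k l A₀≢0 B₀≢0
         (≃-trans (≃-sym ΠQs≃) (≃-trans (≃-sym (⟪_⟫ {P} {product Qs} P≈ΠQs))
           (≃-trans (⟪_⟫ {P} {product Rs} P≈ΠRs) ΠRs≃)))
  = Perm.↭-trans Qs↭ (Perm.↭-trans
      (Permₚ.++⁺ˡ (replicate k (X^ 1))
        -- `X^ k` has value 1 at 1, so what remains still has value 8 = 2³.
        (unique-factorisation 3 ℕ.≤-refl Qs′ Rs′ Qs′-irr Rs′-irr A₀≢0 (begin
          eval (product Qs′) 1           ≡⟨ eval-X^-* k (product Qs′) ⟨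
          eval (X^ k * product Qs′) 1    ≡⟨ eval-cong (product Qs) (X^ k * product Qs′) 1 (ΠQs≃ .at) ⟨
          eval (product Qs) 1            ≡⟨ eval-cong P (product Qs) 1 P≈ΠQs ⟨
          eval P 1                       ≡⟨ P₁≡8 ⟩
          8                              ∎) A≃B))
      (Perm.↭-sym Rs↭))
  where open ≡-Reasoning
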